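{- Let $\bar a=(a_1,\dots,a_s)$ be a composition and let $l$ be a positive integer with $2l\le\min_i a_i$. Then the rank polynomial of the chainlink poset $\mathrm{P_{CL}}(\bar a,l)$ is symmetric (palindromic).
   Context: A composition is a finite tuple of positive integers. For a composition $\bar a=(a_1,\dots,a_s)$ and a positive integer $l$ with $2l\le\min_i a_i$, the chainlink poset $\mathrm{P_{CL}}(\bar a,l)$ has elements $y_{i,j}$ for $1\le i\le s$, $1\le j\le a_i$, with order generated by $y_{i,1}\prec y_{i,2}\prec\dots\prec y_{i,a_i}$ for each $i$, together with $y_{i,a_i-l+j}\succeq y_{i+1,j}$ for each $i$ and $1\le j\le l$ (with $i+1$ taken cyclically modulo $s$). That is, the $l$ top elements of each chain are linked, in order, to lie above the $l$ bottom elements of the next chain. The rank polynomial of a finite poset $P$ is $\sum_I q^{|I|}$ over all lower ideals (down-closed subsets) $I$. A polynomial $f(q)$ is symmetric if $q^Nf(q^{ -1})=f(q)$ for some integer $N$. -}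

module Defs where

open import Data.Empty using (⊥-elim)
open import Data.Fin using (Fin; zero; suc; toℕ; fromℕ<)
import Data.Fin.Properties as Fin
open import Data.Fin.Subset using (Subset; inside; outside; _∈_; ∣_∣)
open import Data.Fin.Subset.Properties using (_∈?_)
import Data.Integer as ℤ
open import Data.Integer using (ℤ; +_; -[1+_]; 0ℤ; 1ℤ)
open import Data.List using (List; []; _∷_; _++_; map; filter; foldr)
open import Data.Nat using (ℕ; zero; suc; _+_; _*_; _∸_; _≤_; _<_; _≤?_; NonZero; >-nonZero⁻¹)
open import Data.Nat.DivMod using (_mod_)
import Data.Nat.Properties as ℕ
open import Data.Product using (Σ-syntax; ∃-syntax; _×_; _,_; proj₂)
open import Data.Sum using (_⊎_; inj₁; inj₂)
open import Data.Sum.Function.Propositional using (_⊎-↔_)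
open import Data.Vec using ([]; _∷_)
open import Function.Base using (_∘_)
open import Function.Bundles using (Inverse; _↔_; mk↔ₛ′)
open import Function.Construct.Composition using (_↔-∘_)
open import Function.Construct.Identity using (↔-id)
open import Function.Construct.Symmetry using (↔-sym)
open import Relation.Binary using (IsPartialOrder; Decidable; Transitive; Antisymmetric)
open import Relation.Binary.Construct.Closure.ReflexiveTransitive using (Star; ε; _◅_; _◅◅_; fold)
open import Relation.Binary.PropositionalEquality using (_≡_; refl; sym; trans; cong; subst; subst₂; isEquivalence)
open import Relation.Nullary using (Dec)
open import Relation.Nullary.Decidable using (map′; _×-dec_; _⊎-dec_; _→-dec_)

-- Coefficients are listed from the constant term upwards.  Trailing zeros are
-- allowed, so polynomials are compared through their coefficients.
Polynomial : Set
Polynomial = List ℤ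

infixl 6 _⊕_

_⊕_ : Polynomial → Polynomial → Polynomial
[]       ⊕ g        = g
(c ∷ f)  ⊕ []       = c ∷ f
(c ∷ f)  ⊕ (d ∷ g)  = (c ℤ.+ d) ∷ (f ⊕ g)

q^_ : ℕ → Polynomial
q^ zero  = 1ℤ ∷ []
q^ suc n = 0ℤ ∷ q^ n

∑ : List Polynomial → Polynomial
∑ = foldr _⊕_ []

-- Since f(q⁻¹) involves negative powers of q, the symmetry equation is read in
-- ℤ[q,q⁻¹], an element being given by its coefficients at all integer exponents.
LaurentCoefficients : Set
LaurentCoefficients = ℤ → ℤ

coefficients : Polynomial → LaurentCoefficients
coefficients []      _           = 0ℤ
coefficients (c ∷ f) (+ zero)    = c
coefficients (c ∷ f) (+ suc n)   = coefficients f (+ n)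
coefficients (c ∷ f) (-[1+ n ])  = 0ℤ

substitute-q⁻¹ : LaurentCoefficients → LaurentCoefficients
substitute-q⁻¹ f m = f (ℤ.- m)

multiply-q^ : ℤ → LaurentCoefficients → LaurentCoefficients
multiply-q^ N f m = f (m ℤ.- N)

Symmetric : Polynomial → Set
Symmetric f = ∃[ N ] (∀ m →
  multiply-q^ N (substitute-q⁻¹ (coefficients f)) m ≡ coefficients f m)

-- Subsets of the carrier are represented through the enumeration; its order is
-- unrelated to ≼.
record FinitePoset : Set₁ where
  infix 4 _≼_ _≼?_
  field
    Carrier        : Set
    _≼_            : Carrier → Carrier → Set
    isPartialOrder : IsPartialOrder _≡_ _≼_
    _≼?_           : Decidable _≼_
    size           : ℕ
    enumeration    : Carrier ↔ Fin size

subsets : ∀ n → List (Subset n)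
subsets zero    = [] ∷ []
subsets (suc n) = map (outside ∷_) (subsets n) ++ map (inside ∷_) (subsets n)

module _ (P : FinitePoset) where
  open FinitePoset P
  open Inverse enumeration using (to; from; strictlyInverseʳ)

  IsLowerIdeal : Subset size → Set
  IsLowerIdeal I = ∀ x y → x ≼ y → to y ∈ I → to x ∈ I

  isLowerIdeal? : ∀ I → Dec (IsLowerIdeal I)
  isLowerIdeal? I = map′
    (λ h x y → subst₂ Closed (strictlyInverseʳ x) (strictlyInverseʳ y) (h (to x) (to y)))
    (λ h i j → h (from i) (from j))
    (Fin.all? λ i → Fin.all? λ j →
      (from i ≼? from j) →-dec ((to (from j) ∈? I) →-dec (to (from i) ∈? I)))
    where
    Closed : Carrier → Carrier → Set
    Closed x y = x ≼ y → to y ∈ I → to x ∈ I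

  lowerIdeals : List (Subset size)
  lowerIdeals = filter isLowerIdeal? (subsets size)

  rankPolynomial : Polynomial
  rankPolynomial = ∑ (map (λ I → q^ ∣ I ∣) lowerIdeals)

-- Compositions are nonempty, so that the minimum of the parts exists.
record Composition : Set where
  field
    length       : ℕ
    {{nonEmpty}} : NonZero length
    part         : Fin length → ℕ
    positive     : ∀ i → NonZero (part i)

open Composition using (length; part)

cyclicSuc : ∀ {s} {{_ : NonZero s}} → Fin s → Fin s
cyclicSuc {s} i = suc (toℕ i) mod s

total : ∀ {s} → (Fin s → ℕ) → ℕ
total {zero}  a = 0
total {suc s} a = a zero + total (a ∘ suc)

enumerateΣ : ∀ {s} (a : Fin s → ℕ) → (Σ[ i ∈ Fin s ] Fin (a i)) ↔ Fin (total a)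
enumerateΣ {zero}  a = mk↔ₛ′ (λ ()) (λ ()) (λ ()) (λ ())
enumerateΣ {suc s} a =
  ↔-sym Fin.+↔⊎ ↔-∘ ((↔-id _ ⊎-↔ enumerateΣ (a ∘ suc)) ↔-∘ mk↔ₛ′
    (λ { (zero , j) → inj₁ j ; (suc i , j) → inj₂ (i , j) })
    (λ { (inj₁ j) → zero , j ; (inj₂ (i , j)) → suc i , j })
    (λ { (inj₁ j) → refl ; (inj₂ (i , j)) → refl })
    (λ { (zero , j) → refl ; (suc i , j) → refl }))

module Chainlink (a : Composition) (l : ℕ) where

  next : Fin (length a) → Fin (length a)
  next = cyclicSuc

  -- Both indices are 0-based: the pair (i , j) is y_{i+1,j+1}.
  Element : Set
  Element = Σ[ i ∈ Fin (length a) ] Fin (part a i)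

  infix 4 _⋖_ _≼_

  data _⋖_ : Element → Element → Set where
    chain : ∀ i {j k : Fin (part a i)} → toℕ k ≡ suc (toℕ j) → (i , j) ⋖ (i , k)
    link  : ∀ i (j : Fin l) {low : Fin (part a (next i))} {high : Fin (part a i)} →
            toℕ low ≡ toℕ j → toℕ high ≡ (part a i ∸ l) + toℕ j →
            (next i , low) ⋖ (i , high)

  _≼_ : Element → Element → Set
  _≼_ = Star _⋖_

  -- An explicit description of ≼, used only to show that ≼ is antisymmetric
  -- and decidable.
  infix 4 _⊑_

  _⊑_ : Element → Element → Set
  (k , b) ⊑ (i , t) =
    (k ≡ i × toℕ b ≤ toℕ t) ⊎ (k ≡ next i × toℕ b + (part a i ∸ l) ≤ toℕ t)

  _⊑?_ : Decidable _⊑_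
  (k , b) ⊑? (i , t) =
    ((k Fin.≟ i) ×-dec (toℕ b ≤? toℕ t)) ⊎-dec
    ((k Fin.≟ next i) ×-dec (toℕ b + (part a i ∸ l) ≤? toℕ t))

  module _ {{_ : NonZero l}} (2l≤a : ∀ i → 2 * l ≤ part a i) where

    l≤a∸l : ∀ i → l ≤ part a i ∸ l
    l≤a∸l i = ℕ.m+n≤o⇒m≤o∸n l
      (subst (λ x → l + x ≤ part a i) (ℕ.+-identityʳ l) (2l≤a i))

    l≤a : ∀ i → l ≤ part a i
    l≤a i = ℕ.≤-trans (l≤a∸l i) (ℕ.m∸n≤m (part a i) l)

    shift< : ∀ i {b t} → b + (part a i ∸ l) ≤ t → b < t
    shift< i {b} p = ℕ.<-≤-trans
      (ℕ.m<m+n b (ℕ.<-≤-trans (>-nonZero⁻¹ l) (l≤a∸l i))) p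

    below-l : ∀ i {b t} → b + (part a i ∸ l) ≤ t → t < part a i → b < l
    below-l i {b} p t<a = ℕ.+-cancelʳ-< (part a i ∸ l) b l
      (subst (b + (part a i ∸ l) <_) (sym (ℕ.m+[n∸m]≡n (l≤a i))) (ℕ.≤-<-trans p t<a))

    ⊑-trans : Transitive _⊑_
    ⊑-trans (inj₁ (refl , p)) (inj₁ (refl , q)) = inj₁ (refl , ℕ.≤-trans p q)
    ⊑-trans (inj₁ (refl , p)) (inj₂ (e , q))    =
      inj₂ (e , ℕ.≤-trans (ℕ.+-monoˡ-≤ _ p) q)
    ⊑-trans (inj₂ (e , p))    (inj₁ (refl , q)) = inj₂ (e , ℕ.≤-trans p q)
    ⊑-trans {c , u} {k , b} {i , t} (inj₂ (_ , p)) (inj₂ (_ , q)) =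
      ⊥-elim (ℕ.<⇒≱ (below-l i q (Fin.toℕ<n t))
        (ℕ.≤-trans (l≤a∸l k) (ℕ.≤-trans (ℕ.m≤n+m _ (toℕ u)) p)))

    ⊑⇒toℕ≤ : ∀ {x y} → x ⊑ y → toℕ (proj₂ x) ≤ toℕ (proj₂ y)
    ⊑⇒toℕ≤ (inj₁ (_ , p)) = p
    ⊑⇒toℕ≤ {y = i , _} (inj₂ (_ , p)) = ℕ.<⇒≤ (shift< i p)

    ⊑-antisym : Antisymmetric _≡_ _⊑_
    ⊑-antisym {k , b} {_ , t} (inj₁ (refl , p)) r =
      cong (k ,_) (Fin.toℕ-injective (ℕ.≤-antisym p (⊑⇒toℕ≤ {k , t} {k , b} r)))
    ⊑-antisym {k , b} {i , t} (inj₂ (_ , p)) r =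
      ⊥-elim (ℕ.<⇒≱ (shift< i p) (⊑⇒toℕ≤ {i , t} {k , b} r))

    ⋖⇒⊑ : ∀ {x y} → x ⋖ y → x ⊑ y
    ⋖⇒⊑ (chain i e)     = inj₁ (refl , ℕ.≤-trans (ℕ.n≤1+n _) (ℕ.≤-reflexive (sym e)))
    ⋖⇒⊑ (link i j e e′) = inj₂ (refl , ℕ.≤-reflexive
      (trans (cong (_+ (part a i ∸ l)) e) (trans (ℕ.+-comm (toℕ j) _) (sym e′))))

    ≼⇒⊑ : ∀ {x y} → x ≼ y → x ⊑ y
    ≼⇒⊑ = fold _⊑_
      (λ {x} {y} {z} r s → ⊑-trans {x} {y} {z} (⋖⇒⊑ r) s)
      (inj₁ (refl , ℕ.≤-refl))

    climb : ∀ d i (j k : Fin (part a i)) → toℕ k ≡ d + toℕ j → (i , j) ≼ (i , k)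
    climb zero    i j k e = subst (λ x → (i , j) ≼ (i , x)) (Fin.toℕ-injective (sym e)) ε
    climb (suc d) i j k e = climb d i j k⁻ (Fin.toℕ-fromℕ< k⁻<a) ◅◅
      chain i (trans e (cong suc (sym (Fin.toℕ-fromℕ< k⁻<a)))) ◅ ε
      where
      k⁻<a : d + toℕ j < part a i
      k⁻<a = ℕ.≤-trans (ℕ.≤-reflexive (sym e)) (ℕ.<⇒≤ (Fin.toℕ<n k))
      k⁻ : Fin (part a i)
      k⁻ = fromℕ< k⁻<a

    climb-≤ : ∀ i (j k : Fin (part a i)) → toℕ j ≤ toℕ k → (i , j) ≼ (i , k)
    climb-≤ i j k p = climb (toℕ k ∸ toℕ j) i j k (sym (ℕ.m∸n+n≡m p))

    ⊑⇒≼ : ∀ {x y} → x ⊑ y → x ≼ y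
    ⊑⇒≼ {k , b} {_ , t} (inj₁ (refl , p)) = climb-≤ k b t p
    ⊑⇒≼ {_ , b} {i , t} (inj₂ (refl , p)) =
      link i (fromℕ< b<l) (sym (Fin.toℕ-fromℕ< b<l))
        (trans (Fin.toℕ-fromℕ< h<a)
          (trans (ℕ.+-comm (toℕ b) _)
            (cong (λ x → (part a i ∸ l) + x) (sym (Fin.toℕ-fromℕ< b<l)))))
      ◅ climb-≤ i (fromℕ< h<a) t (subst (_≤ toℕ t) (sym (Fin.toℕ-fromℕ< h<a)) p)
      where
      b<l : toℕ b < l
      b<l = below-l i p (Fin.toℕ<n t)
      h<a : toℕ b + (part a i ∸ l) < part a i
      h<a = ℕ.≤-<-trans p (Fin.toℕ<n t)

    poset : FinitePoset
    poset = record
      { Carrier        = Element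
      ; _≼_            = _≼_
      ; isPartialOrder = record
        { isPreorder = record
          { isEquivalence = isEquivalence
          ; reflexive     = λ { refl → ε }
          ; trans         = _◅◅_
          }
        ; antisym = λ {x} {y} p q → ⊑-antisym {x} {y} (≼⇒⊑ p) (≼⇒⊑ q)
        }
      ; _≼?_           = λ x y → map′ ⊑⇒≼ ≼⇒⊑ (x ⊑? y)
      ; size           = total (part a)
      ; enumeration    = enumerateΣ (part a)
      }

P-CL : (a : Composition) (l : ℕ) {{_ : NonZero l}} →
       (∀ i → 2 * l ≤ part a i) → FinitePoset
P-CL a l = Chainlink.poset a l

{-# OPTIONS --safe #-}

-- A lower ideal fills each chain i up to a height t i ≤ a i, subject to
-- t i ≤ t (i + 1) + (a i - l) for all i, cyclically.  As 2 l ≤ a i, two consecutive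
-- links are never both violated, so inclusion-exclusion over the violated links
-- turns the rank polynomial into the trace of a product of 2×2 matrices
-- [[g , - x W] , [1 , 0]], one for each chain, with g = 1 + q + … + q^(a i),
-- x = q^(a i - l + 1) and W independent of i.  For the reversed polynomial the
-- factors are [[g , - W] , [x , 0]] instead.  Since (1 - q) g + q^l x = 1, all factors
-- are affine in x, and one matrix conjugates every factor of the first kind to the
-- factor of the second kind with the same x; hence the traces agree.  Polynomials
-- are compared through their values at the positive integers.

module Submission where

open import Defs
open import Data.Fin as Fin using (Fin; zero; suc; toℕ; fromℕ; fromℕ<; inject₁; _↑ˡ_; _↑ʳ_)
open import Data.Fin.Permutation using (reverse)
import Data.Fin.Properties as Fin
open import Data.Fin.Relation.Unary.Top using (view; ‵fromℕ; ‵inject₁)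
open import Data.Fin.Subset using (Subset; inside; outside; ∣_∣)
open import Data.Fin.Subset.Properties using (∣p∣≤n)
open import Data.Integer as ℤ using (ℤ; +_; -[1+_]; 0ℤ; 1ℤ; _+_; _-_; _*_; _^_; -_)
import Data.Integer.Properties as ℤ
open import Data.Integer.Tactic.RingSolver using (solve-∀)
open import Data.List as List using (List; []; _∷_)
import Data.List.Properties as List
open import Data.List.Relation.Unary.All as All using (All; []; _∷_)
import Data.List.Relation.Unary.All.Properties as All
open import Data.Nat as ℕ using (ℕ; zero; suc; _∸_; _≤_; _<_; _≤?_; _<?_; z≤n; s≤s; NonZero)
open import Data.Nat.DivMod using (_%_; m%n<n; m<n⇒m%n≡m; n%n≡0)
import Data.Nat.Properties as ℕ
open import Data.Product using (Σ-syntax; ∃-syntax; _×_; _,_; proj₁; proj₂)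
open import Data.Sum using (inj₁; inj₂)
open import Data.Unit using (⊤; tt)
open import Data.Vec as Vec using (Vec; []; _∷_; lookup; take; drop; head; tail; _∷ʳ_)
open import Data.Vec.Properties using (take++drop≡id; lookup-++ˡ; lookup-++ʳ; []=⇒lookup; lookup⇒[]=)
open import Function.Base using (_∘_)
open import Function.Bundles using (Inverse)
open import Relation.Binary.PropositionalEquality hiding ([_])
open import Relation.Nullary using (¬_; Dec; yes; no; contradiction)
open import Relation.Nullary.Decidable using (_×-dec_)
open import Relation.Unary using (Pred; Decidable)
open import Algebra.Properties.Semiring.Sum ℤ.+-*-semiring
  using (sum; sum-cong-≗; sum-replicate-zero; ∑-distrib-+; ∑-comm; sum-permute; *-distribˡ-sum; *-distribʳ-sum)
open import Algebra.Properties.AbelianGroup ℤ.+-0-abelianGroup using (∙-cancelˡ)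
open ≡-Reasoning

-- Polynomials and their values

eval : ℤ → Polynomial → ℤ
eval q []      = 0ℤ
eval q (c ∷ f) = c + q * eval q f

eval-⊕ : ∀ q f g → eval q (f ⊕ g) ≡ eval q f + eval q g
eval-⊕ q []      g       = sym (ℤ.+-identityˡ _)
eval-⊕ q (c ∷ f) []      = sym (ℤ.+-identityʳ _)
eval-⊕ q (c ∷ f) (d ∷ g) = trans (cong (λ v → c + d + q * v) (eval-⊕ q f g)) (rearrange q c d _ _)
  where
  rearrange : ∀ q c d v w → c + d + q * (v + w) ≡ c + q * v + (d + q * w)
  rearrange = solve-∀

eval-q^ : ∀ q n → eval q (q^ n) ≡ q ^ n
eval-q^ q zero    = trans (cong (λ v → 1ℤ + v) (ℤ.*-zeroʳ q)) refl
eval-q^ q (suc n) = trans (ℤ.+-identityˡ _) (cong (q *_) (eval-q^ q n))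

-- A nonzero integer has no divisor larger than its absolute value, so the single divisor
-- `suc ℤ.∣ x ∣` decides the matter.
divisible-by-all⇒0 : ∀ x → (∀ k → ∃[ y ] x ≡ + suc k * y) → x ≡ 0ℤ
divisible-by-all⇒0 x divisible with divisible ℤ.∣ x ∣
... | y , x≡ = ℤ.∣i∣≡0⇒i≡0 (vanish ℤ.∣ y ∣ (trans (cong ℤ.∣_∣ x≡) (ℤ.abs-* (+ suc ℤ.∣ x ∣) y)))
  where
  vanish : ∀ m → ℤ.∣ x ∣ ≡ suc ℤ.∣ x ∣ ℕ.* m → ℤ.∣ x ∣ ≡ 0
  vanish zero    e = trans e (ℕ.*-zeroʳ (suc ℤ.∣ x ∣))
  vanish (suc m) e = contradiction (ℕ.≤-reflexive (sym e)) (ℕ.<⇒≱ (ℕ.m≤m*n (suc ℤ.∣ x ∣) (suc m)))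

-- Solving each equation for `c - d` exhibits it as a multiple of every positive integer, hence as
-- zero. What remains can be divided by `+ suc k`; the point q = 0 would not allow this division.
split-constant : ∀ c d (u v : ℕ → ℤ) →
  (∀ k → c + + suc k * u k ≡ d + + suc k * v k) → c ≡ d × (∀ k → u k ≡ v k)
split-constant c d u v equal = c≡d , λ k →
  ℤ.*-cancelˡ-≡ (+ suc k) _ _ (∙-cancelˡ d _ _ (subst (λ e → e + + suc k * u k ≡ d + + suc k * v k) c≡d (equal k)))
  where
  isolate : ∀ c d s u v → c + s * u ≡ d + s * v → c - d ≡ s * (v - u)
  isolate c d s u v e = begin
    c - d                      ≡⟨ expand c d (s * u) ⟩
    (c + s * u) - s * u - d    ≡⟨ cong (λ z → z - s * u - d) e ⟩
    (d + s * v) - s * u - d    ≡⟨ collect d s u v ⟩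
    s * (v - u)                ∎
    where
    expand : ∀ c d w → c - d ≡ (c + w) - w - d
    expand = solve-∀
    collect : ∀ d s u v → (d + s * v) - s * u - d ≡ s * (v - u)
    collect = solve-∀
  c≡d : c ≡ d
  c≡d = ℤ.i-j≡0⇒i≡j c d (divisible-by-all⇒0 (c - d) λ k →
    v k - u k , isolate c d (+ suc k) (u k) (v k) (equal k))

coefficients-∷-cong : ∀ {c d f g} → c ≡ d → (∀ m → coefficients f m ≡ coefficients g m) →
  ∀ m → coefficients (c ∷ f) m ≡ coefficients (d ∷ g) m
coefficients-∷-cong c≡d f≡g (+ zero)  = c≡d
coefficients-∷-cong c≡d f≡g (+ suc n) = f≡g (+ n)
coefficients-∷-cong c≡d f≡g -[1+ n ]  = refl

coefficients-0∷[] : ∀ m → coefficients (0ℤ ∷ []) m ≡ 0ℤ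
coefficients-0∷[] (+ zero)  = refl
coefficients-0∷[] (+ suc n) = refl
coefficients-0∷[] -[1+ n ]  = refl

eval-0∷[] : ∀ q → eval q (0ℤ ∷ []) ≡ 0ℤ
eval-0∷[] q = trans (ℤ.+-identityˡ _) (ℤ.*-zeroʳ q)

-- The constant terms agree because their difference is divisible by every
-- positive integer; then divide by q and repeat.
eval-injective : ∀ f g → (∀ k → eval (+ suc k) f ≡ eval (+ suc k) g) →
  ∀ m → coefficients f m ≡ coefficients g m
eval-injective []      []      equal m = refl
eval-injective []      (d ∷ g) equal m =
  let 0≡d , rest = split-constant 0ℤ d (λ _ → 0ℤ) (λ k → eval (+ suc k) g)
                     (λ k → trans (eval-0∷[] (+ suc k)) (equal k))
  in trans (sym (coefficients-0∷[] m)) (coefficients-∷-cong 0≡d (eval-injective [] g rest) m)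
eval-injective (c ∷ f) []      equal m =
  let c≡0 , rest = split-constant c 0ℤ (λ k → eval (+ suc k) f) (λ _ → 0ℤ)
                     (λ k → trans (equal k) (sym (eval-0∷[] (+ suc k))))
  in trans (coefficients-∷-cong c≡0 (eval-injective f [] rest) m) (coefficients-0∷[] m)
eval-injective (c ∷ f) (d ∷ g) equal m =
  let c≡d , rest = split-constant c d (λ k → eval (+ suc k) f) (λ k → eval (+ suc k) g) equal
  in coefficients-∷-cong c≡d (eval-injective f g rest) m

-- Coefficients of reflected polynomials

coefficients-⊕ : ∀ f g m → coefficients (f ⊕ g) m ≡ coefficients f m + coefficients g m
coefficients-⊕ []      g       m         = sym (ℤ.+-identityˡ _)
coefficients-⊕ (c ∷ f) []      m         = sym (ℤ.+-identityʳ _)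
coefficients-⊕ (c ∷ f) (d ∷ g) (+ zero)  = refl
coefficients-⊕ (c ∷ f) (d ∷ g) (+ suc n) = coefficients-⊕ f g (+ n)
coefficients-⊕ (c ∷ f) (d ∷ g) -[1+ n ]  = refl

coefficient-q^-≡ : ∀ n → coefficients (q^ n) (+ n) ≡ 1ℤ
coefficient-q^-≡ zero    = refl
coefficient-q^-≡ (suc n) = coefficient-q^-≡ n

coefficient-q^-≢ : ∀ n m → m ≢ + n → coefficients (q^ n) m ≡ 0ℤ
coefficient-q^-≢ zero    (+ zero)  m≢n = contradiction refl m≢n
coefficient-q^-≢ zero    (+ suc m) m≢n = refl
coefficient-q^-≢ zero    -[1+ m ]  m≢n = refl
coefficient-q^-≢ (suc n) (+ zero)  m≢n = refl
coefficient-q^-≢ (suc n) (+ suc m) m≢n = coefficient-q^-≢ n (+ m) λ { refl → m≢n refl }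
coefficient-q^-≢ (suc n) -[1+ m ]  m≢n = refl

-- Both sides are Kronecker deltas, and N - m = n holds exactly when m = N - n.
coefficient-q^-reflect : ∀ {N n} → n ≤ N → ∀ m →
  coefficients (q^ n) (+ N - m) ≡ coefficients (q^ (N ∸ n)) m
coefficient-q^-reflect {N} {n} n≤N m with m ℤ.≟ + (N ∸ n)
... | yes refl = begin
  coefficients (q^ n) (+ N - + (N ∸ n))  ≡⟨ cong (coefficients (q^ n)) N-[N-n]≡n ⟩
  coefficients (q^ n) (+ n)              ≡⟨ coefficient-q^-≡ n ⟩
  1ℤ                                     ≡⟨ coefficient-q^-≡ (N ∸ n) ⟨
  coefficients (q^ (N ∸ n)) (+ (N ∸ n))  ∎
  where
  N-[N-n]≡n : + N - + (N ∸ n) ≡ + n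
  N-[N-n]≡n = trans (ℤ.m-n≡m⊖n N (N ∸ n)) (trans (ℤ.⊖-≥ (ℕ.m∸n≤m N n)) (cong +_ (ℕ.m∸[m∸n]≡n n≤N)))
... | no m≢ = trans (coefficient-q^-≢ n (+ N - m) (λ e → m≢ (begin
  m                ≡⟨ flip (+ N) m ⟩
  + N - (+ N - m)  ≡⟨ cong (λ v → + N - v) e ⟩
  + N - + n        ≡⟨ ℤ.m-n≡m⊖n N n ⟩
  N ℤ.⊖ n          ≡⟨ ℤ.⊖-≥ n≤N ⟩
  + (N ∸ n)        ∎))) (sym (coefficient-q^-≢ (N ∸ n) m m≢))
  where
  flip : ∀ N m → m ≡ N - (N - m)
  flip = solve-∀

-- Substituting q⁻¹ and multiplying by q^N turns each q^n into q^(N - n).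
symmetric-if-reflected-eval : ∀ N (ns : List ℕ) → All (_≤ N) ns →
  (∀ k → eval (+ suc k) (∑ (List.map q^_ ns)) ≡ eval (+ suc k) (∑ (List.map (λ n → q^ (N ∸ n)) ns))) →
  Symmetric (∑ (List.map q^_ ns))
symmetric-if-reflected-eval N ns ns≤N equal = + N , λ m → begin
  coefficients (∑ (List.map q^_ ns)) (- (m - + N))            ≡⟨ cong (coefficients (∑ (List.map q^_ ns))) (negate (+ N) m) ⟩
  coefficients (∑ (List.map q^_ ns)) (+ N - m)                ≡⟨ reflect ns≤N m ⟩
  coefficients (∑ (List.map (λ n → q^ (N ∸ n)) ns)) m         ≡⟨ eval-injective (∑ (List.map q^_ ns)) (∑ (List.map (λ n → q^ (N ∸ n)) ns)) equal m ⟨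
  coefficients (∑ (List.map q^_ ns)) m                        ∎
  where
  negate : ∀ N m → - (m - N) ≡ N - m
  negate = solve-∀
  reflect : ∀ {ns} → All (_≤ N) ns → ∀ m →
    coefficients (∑ (List.map q^_ ns)) (+ N - m) ≡ coefficients (∑ (List.map (λ n → q^ (N ∸ n)) ns)) m
  reflect []                     m = refl
  reflect {n ∷ ns} (n≤N ∷ ns≤N)  m = begin
    coefficients (q^ n ⊕ ∑ (List.map q^_ ns)) (+ N - m)
      ≡⟨ coefficients-⊕ (q^ n) _ (+ N - m) ⟩
    coefficients (q^ n) (+ N - m) + coefficients (∑ (List.map q^_ ns)) (+ N - m)
      ≡⟨ cong₂ _+_ (coefficient-q^-reflect n≤N m) (reflect ns≤N m) ⟩
    coefficients (q^ (N ∸ n)) m + coefficients (∑ (List.map (λ n → q^ (N ∸ n)) ns)) m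
      ≡⟨ coefficients-⊕ (q^ (N ∸ n)) _ m ⟨
    coefficients (q^ (N ∸ n) ⊕ ∑ (List.map (λ n → q^ (N ∸ n)) ns)) m ∎

-- Finite sums and indicators

Σ< : ℕ → (ℕ → ℤ) → ℤ
Σ< n f = sum {n} (λ i → f (toℕ i))

infixr 5 Σ<-syntax
Σ<-syntax : ℕ → (ℕ → ℤ) → ℤ
Σ<-syntax = Σ<
syntax Σ<-syntax n (λ t → e) = Σ[ t < n ] e

Σ<-cong : ∀ n {f g : ℕ → ℤ} → (∀ t → t < n → f t ≡ g t) → Σ< n f ≡ Σ< n g
Σ<-cong n f≡g = sum-cong-≗ {n} (λ i → f≡g (toℕ i) (Fin.toℕ<n i))

Σ<-zero : ∀ n {f : ℕ → ℤ} → (∀ t → t < n → f t ≡ 0ℤ) → Σ< n f ≡ 0ℤ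
Σ<-zero n f≡0 = trans (Σ<-cong n f≡0) (sum-replicate-zero n)

Σ<-+ : ∀ n (f g : ℕ → ℤ) → Σ[ t < n ] (f t + g t) ≡ Σ< n f + Σ< n g
Σ<-+ n f g = ∑-distrib-+ {n} _ _

Σ<-*ˡ : ∀ n c (f : ℕ → ℤ) → Σ[ t < n ] (c * f t) ≡ c * Σ< n f
Σ<-*ˡ n c f = sym (*-distribˡ-sum {n} c _)

Σ<-*ʳ : ∀ n c (f : ℕ → ℤ) → Σ[ t < n ] (f t * c) ≡ Σ< n f * c
Σ<-*ʳ n c f = sym (*-distribʳ-sum {n} c _)

Σ<-comm : ∀ m n (f : ℕ → ℕ → ℤ) → Σ[ t < m ] Σ[ u < n ] f t u ≡ Σ[ u < n ] Σ[ t < m ] f t u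
Σ<-comm m n f = ∑-comm {m} {n} _

Σ<-split : ∀ m n (f : ℕ → ℤ) → Σ< (m ℕ.+ n) f ≡ Σ< m f + (Σ[ t < n ] f (m ℕ.+ t))
Σ<-split zero    n f = sym (ℤ.+-identityˡ _)
Σ<-split (suc m) n f =
  trans (cong (λ v → f 0 + v) (Σ<-split m n (f ∘ suc))) (sym (ℤ.+-assoc (f 0) _ _))

Σ<-reverse : ∀ n (f : ℕ → ℤ) → Σ< n f ≡ Σ[ t < n ] f (n ∸ suc t)
Σ<-reverse n f = trans (sum-permute {n} {n} _ reverse) (sum-cong-≗ {n} (λ i → cong f (Fin.opposite-prop i)))

Σ<-linear : ∀ n c d (f g : ℕ → ℤ) → Σ[ t < n ] (c * f t + d * g t) ≡ c * Σ< n f + d * Σ< n g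
Σ<-linear n c d f g = trans (Σ<-+ n (λ t → c * f t) (λ t → d * g t)) (cong₂ _+_ (Σ<-*ˡ n c f) (Σ<-*ˡ n d g))

indicator : ∀ {P : Set} → Dec P → ℤ
indicator (yes _) = 1ℤ
indicator (no _)  = 0ℤ

indicator-cong : ∀ {P Q : Set} (p : Dec P) (q : Dec Q) → (P → Q) → (Q → P) → indicator p ≡ indicator q
indicator-cong (yes _) (yes _) _ _ = refl
indicator-cong (yes p) (no ¬q) f _ = contradiction (f p) ¬q
indicator-cong (no ¬p) (yes q) _ g = contradiction (g q) ¬p
indicator-cong (no _)  (no _)  _ _ = refl

indicator-yes : ∀ {P : Set} (p : Dec P) → P → indicator p ≡ 1ℤ
indicator-yes p x = indicator-cong p (yes x) (λ _ → x) (λ _ → x)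

indicator-× : ∀ {P Q : Set} (p : Dec P) (q : Dec Q) → indicator (p ×-dec q) ≡ indicator p * indicator q
indicator-× (yes _) (yes _) = refl
indicator-× (yes _) (no _)  = refl
indicator-× (no _)  (yes _) = refl
indicator-× (no _)  (no _)  = refl

-- Products of 2×2 matrices

-- P M = N P for P = [[h , k W] , [- k , 1]], divided by det P.  Here M is a product
-- of matrices [[g , - x W] , [1 , 0]] and N the product of the corresponding
-- [[g , - W] , [x , 0]], where k g + h x = 1 for each factor.
record Intertwined (k h W m₁ m₂ m₃ m₄ n₁ n₂ n₃ n₄ : ℤ) : Set where
  constructor intertwined
  field
    e   : ℤ
    n₁≡ : n₁ ≡ m₁ + k * e
    m₄≡ : m₄ ≡ n₄ + k * e
    n₂≡ : n₂ ≡ h * e - W * m₃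
    m₂≡ : m₂ ≡ e - W * n₃
    m₃≡ : m₃ ≡ h * n₃ - k * (n₄ - m₁)

-- The two diagonals differ by the same multiple `k * e`, once in the first entry and once in the
-- last. With `e` given as a witness nothing has to be divided by k, which will be 1 - q and
-- vanishes at q = 1.
intertwined⇒trace≡ : ∀ {k h W m₁ m₂ m₃ m₄ n₁ n₂ n₃ n₄} →
  Intertwined k h W m₁ m₂ m₃ m₄ n₁ n₂ n₃ n₄ → m₁ + m₄ ≡ n₁ + n₄
intertwined⇒trace≡ {k} {m₁ = m₁} {n₄ = n₄} (intertwined e refl refl _ _ _) = identity m₁ n₄ (k * e)
  where
  identity : ∀ m n e → m + (n + e) ≡ m + e + n
  identity = solve-∀

intertwined-cong : ∀ {k h W m₁ m₂ m₃ m₄ n₁ n₂ n₃ n₄ m₁′ m₂′ m₃′ m₄′ n₁′ n₂′ n₃′ n₄′} →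
  m₁ ≡ m₁′ → m₂ ≡ m₂′ → m₃ ≡ m₃′ → m₄ ≡ m₄′ → n₁ ≡ n₁′ → n₂ ≡ n₂′ → n₃ ≡ n₃′ → n₄ ≡ n₄′ →
  Intertwined k h W m₁ m₂ m₃ m₄ n₁ n₂ n₃ n₄ → Intertwined k h W m₁′ m₂′ m₃′ m₄′ n₁′ n₂′ n₃′ n₄′
intertwined-cong refl refl refl refl refl refl refl refl i = i

-- Makes the ring solver work modulo the relation `k * g + h * x ≡ 1ℤ`: the discrepancy is supplied
-- as an explicit multiple of `z - 1ℤ`.
≡-modulo : ∀ {z} → z ≡ 1ℤ → ∀ {a b} c → a ≡ b + (z - 1ℤ) * c → a ≡ b
≡-modulo refl {b = b} c e = trans e (ℤ.+-identityʳ b)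

module _ {k h W : ℤ} (g x : ℤ) (kg+hx≡1 : k * g + h * x ≡ 1ℤ) where

  -- For a single factor `e` is 0 and the equation for m₃ is the relation between g and x itself.
  -- The factors `1ℤ` and `0ℤ` are written out to match the columns `topʳ` and `bottomʳ` of a single
  -- part.
  intertwined-base : Intertwined k h W
    g (- (x * W * 1ℤ)) 1ℤ        (- (x * W * 0ℤ))
    g (- (W * 1ℤ))     (x * 1ℤ) (- (W * (x * 0ℤ)))
  intertwined-base = intertwined 0ℤ (n₁ g k) (m₄ k x W) (n₂ h W) (m₂ x W) (trans (sym kg+hx≡1) (m₃ k g h x W))
    where
    n₁ : ∀ g k → g ≡ g + k * 0ℤ
    n₁ = solve-∀
    m₄ : ∀ k x W → - (x * W * 0ℤ) ≡ - (W * (x * 0ℤ)) + k * 0ℤ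
    m₄ = solve-∀
    n₂ : ∀ h W → - (W * 1ℤ) ≡ h * 0ℤ - W * 1ℤ
    n₂ = solve-∀
    m₂ : ∀ x W → - (x * W * 1ℤ) ≡ 0ℤ - W * (x * 1ℤ)
    m₂ = solve-∀
    m₃ : ∀ k g h x W → k * g + h * x ≡ h * (x * 1ℤ) - k * (- (W * (x * 0ℤ)) - g)
    m₃ = solve-∀

  -- Multiplies both products on the left by the matrices of one more factor. The given equations
  -- eliminate all entries but m₁, n₃, n₄ and `e`; each new equation is then a ring identity, in
  -- four of the five cases up to a multiple of k g + h x - 1.
  intertwined-step : ∀ {m₁ m₂ m₃ m₄ n₁ n₂ n₃ n₄} → Intertwined k h W m₁ m₂ m₃ m₄ n₁ n₂ n₃ n₄ →
    Intertwined k h W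
      (g * m₁ - x * W * m₃) (g * m₂ - x * W * m₄) m₁ m₂
      (g * n₁ - W * n₃)     (g * n₂ - W * n₄)     (x * n₁) (x * n₂)
  intertwined-step {m₁ = a} {n₃ = b} {n₄ = c} (intertwined e refl refl refl refl refl) = intertwined
    -- The equation for m₂ forces this witness: it is m₂ + W n₃ in terms of the new entries.
    (g * (e - W * b) - x * W * (c + k * e) + W * (x * (a + k * e)))
    (≡-modulo kg+hx≡1 _ (n₁ k h W g x a b c e))
    (≡-modulo kg+hx≡1 _ (m₄ k h W g x a b c e))
    (≡-modulo kg+hx≡1 _ (n₂ k h W g x a b c e))
    (m₂ k h W g x a b c e)
    (≡-modulo kg+hx≡1 _ (m₃ k h W g x a b c e))
    where
    n₁ : ∀ k h W g x a b c e → g * (a + k * e) - W * b ≡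
      g * a - x * W * (h * b - k * (c - a)) + k * (g * (e - W * b) - x * W * (c + k * e) + W * (x * (a + k * e)))
      + (k * g + h * x - 1ℤ) * (W * b)
    n₁ = solve-∀
    m₄ : ∀ k h W g x a b c e → e - W * b ≡
      x * (h * e - W * (h * b - k * (c - a))) + k * (g * (e - W * b) - x * W * (c + k * e) + W * (x * (a + k * e)))
      + (k * g + h * x - 1ℤ) * (- (e - W * b))
    m₄ = solve-∀
    n₂ : ∀ k h W g x a b c e → g * (h * e - W * (h * b - k * (c - a))) - W * c ≡
      h * (g * (e - W * b) - x * W * (c + k * e) + W * (x * (a + k * e))) - W * a
      + (k * g + h * x - 1ℤ) * (W * (c - a))
    n₂ = solve-∀
    m₂ : ∀ k h W g x a b c e → g * (e - W * b) - x * W * (c + k * e) ≡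
      (g * (e - W * b) - x * W * (c + k * e) + W * (x * (a + k * e))) - W * (x * (a + k * e))
    m₂ = solve-∀
    m₃ : ∀ k h W g x a b c e → a ≡
      h * (x * (a + k * e)) - k * (x * (h * e - W * (h * b - k * (c - a))) - (g * a - x * W * (h * b - k * (c - a))))
      + (k * g + h * x - 1ℤ) * (- a)
    m₃ = solve-∀

-- Sums over cyclically linked fillings

module Cycle (l : ℕ) (w : ℕ → ℕ → ℤ) where

  allowed violated : ℕ → ℕ → ℕ → ℤ
  allowed  a t u = indicator (t ≤? u ℕ.+ (a ∸ l))
  violated a t u = indicator (u ℕ.+ (a ∸ l) <? t)

  -- The source of the inclusion-exclusion: each link condition becomes 1 minus its violation.
  allowed≡1-violated : ∀ a t u → allowed a t u ≡ 1ℤ - violated a t u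
  allowed≡1-violated a t u with t ≤? u ℕ.+ (a ∸ l) | u ℕ.+ (a ∸ l) <? t
  ... | yes p | yes q = contradiction q (ℕ.≤⇒≯ p)
  ... | yes _ | no _  = refl
  ... | no _  | yes _ = refl
  ... | no p  | no q  = contradiction (ℕ.≮⇒≥ q) p

  violated≡0 : ∀ a {t u} → t ≤ u ℕ.+ (a ∸ l) → violated a t u ≡ 0ℤ
  -- The refuted proposition `t < t` stands for falsity; its indicator computes to `0ℤ`.
  violated≡0 a {t} {u} p = indicator-cong (u ℕ.+ (a ∸ l) <? t) (no (λ (x : t < t) → ℕ.<-irrefl refl x))
    (λ q → contradiction q (ℕ.≤⇒≯ p)) (λ q → contradiction q (ℕ.<-irrefl refl))

  -- The total weight when the first part has value t and the last link leads to z.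
  path : ∀ {n} → (Fin (suc n) → ℕ) → ℕ → ℕ → ℤ
  path {zero}  a t z = w (a zero) t * allowed (a zero) t z
  path {suc n} a t z = w (a zero) t *
    (Σ[ u < suc (a (suc zero)) ] allowed (a zero) t u * path (a ∘ suc) u z)

  pathSum pathSum⁺ : ∀ {n} → (Fin (suc n) → ℕ) → ℕ → ℤ
  pathSum a z = Σ[ t < suc (a zero) ] path a t z
  pathSum⁺ {zero}  a z = 1ℤ
  pathSum⁺ {suc n} a z = pathSum (a ∘ suc) z

  weight : ℕ → ℤ
  weight a = Σ< (suc a) (w a)

  defectFrom : ℕ → ℕ → ℕ → ℤ
  defectFrom a b t = Σ[ u < suc b ] w b u * violated a t u

  defectInto : ℕ → ℕ → ℤ
  defectInto a u = Σ[ t < suc a ] w a t * violated a t u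

  defect : ℕ → ℕ → ℤ
  defect a b = Σ[ t < suc a ] Σ[ u < suc b ] w a t * w b u * violated a t u

  defect≡ΣdefectFrom : ∀ a b → (Σ[ t < suc a ] w a t * defectFrom a b t) ≡ defect a b
  defect≡ΣdefectFrom a b = Σ<-cong (suc a) λ t _ →
    trans (sym (Σ<-*ˡ (suc b) (w a t) (λ u → w b u * violated a t u)))
      (Σ<-cong (suc b) λ u _ → sym (ℤ.*-assoc (w a t) (w b u) (violated a t u)))

  defect≡ΣdefectInto : ∀ a b → Σ[ u < suc b ] w b u * defectInto a u ≡ defect a b
  defect≡ΣdefectInto a b = trans (Σ<-cong (suc b) λ u _ →
    trans (sym (Σ<-*ˡ (suc a) (w b u) (λ t → w a t * violated a t u)))
      (Σ<-cong (suc a) λ t _ → swap (w a t) (w b u) (violated a t u)))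
    (Σ<-comm (suc b) (suc a) (λ u t → w a t * w b u * violated a t u))
    where
    swap : ∀ x y z → y * (x * z) ≡ x * y * z
    swap = solve-∀

  -- The columns of the product of the matrices [[weight a , - defect a b] , [1 , 0]]
  -- for consecutive parts a, b.  No link leaves the last part, so its matrix is
  -- [[weight a , 1] , [1 , 0]]: the factor - defect of the closing link is left out of
  -- the right column.
  topˡ topʳ bottomˡ bottomʳ : ∀ {n} → (Fin (suc n) → ℕ) → ℤ
  topˡ {zero}  a = weight (a zero)
  topˡ {suc n} a = weight (a zero) * topˡ (a ∘ suc) - defect (a zero) (a (suc zero)) * bottomˡ (a ∘ suc)
  bottomˡ {zero}  a = 1ℤ
  bottomˡ {suc n} a = topˡ (a ∘ suc)
  topʳ {zero}  a = 1ℤ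
  topʳ {suc n} a = weight (a zero) * topʳ (a ∘ suc) - defect (a zero) (a (suc zero)) * bottomʳ (a ∘ suc)
  bottomʳ {zero}  a = 0ℤ
  bottomʳ {suc n} a = topʳ (a ∘ suc)

  last : ∀ {n} → (Fin (suc n) → ℕ) → ℕ
  last {n} a = a (fromℕ n)

  l≤a∸l : ∀ {a} → 2 ℕ.* l ≤ a → l ≤ a ∸ l
  l≤a∸l {a} p = ℕ.m+n≤o⇒m≤o∸n l (subst (λ x → l ℕ.+ x ≤ a) (ℕ.+-identityʳ l) p)

  l≤a : ∀ {a} → 2 ℕ.* l ≤ a → l ≤ a
  l≤a {a} p = ℕ.≤-trans (l≤a∸l p) (ℕ.m∸n≤m a l)

  -- A link out of a chain can be violated only at a height above a - l, which is at least l. By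
  -- `violated-high` a link into a chain can be violated only at a height below l. So the two links
  -- at a chain are never violated together.
  violated-low : ∀ {a} → 2 ℕ.* l ≤ a → ∀ {t} u → t < l → violated a t u ≡ 0ℤ
  violated-low {a} p u t<l = violated≡0 a (ℕ.≤-trans (ℕ.<⇒≤ t<l) (ℕ.≤-trans (l≤a∸l p) (ℕ.m≤n+m (a ∸ l) u)))

  violated-high : ∀ {a} → 2 ℕ.* l ≤ a → ∀ {t u} → t ≤ a → l ≤ u → violated a t u ≡ 0ℤ
  violated-high {a} p {t} {u} t≤a l≤u = violated≡0 a (ℕ.≤-trans t≤a
    (subst (_≤ u ℕ.+ (a ∸ l)) (ℕ.m+[n∸m]≡n (l≤a p)) (ℕ.+-monoˡ-≤ (a ∸ l) l≤u)))

  -- Violations occur only for heights above a - l in the first chain and below l in the second.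
  -- Counting the first height from a - l + 1 turns the strict inequality into `u ≤ t`, a condition
  -- free of a and b.
  defect-overlap : ∀ a b → 2 ℕ.* l ≤ a → 2 ℕ.* l ≤ b →
    defect a b ≡ (Σ[ t < l ] Σ[ u < l ] w a (suc (a ∸ l) ℕ.+ t) * w b u * indicator (u ≤? t))
  defect-overlap a b 2l≤a 2l≤b = begin
    Σ< (suc a) f
      ≡⟨ cong (λ m → Σ< (suc m) f) (ℕ.m∸n+n≡m (l≤a 2l≤a)) ⟨
    Σ< (suc (a ∸ l) ℕ.+ l) f
      ≡⟨ Σ<-split (suc (a ∸ l)) l f ⟩
    Σ< (suc (a ∸ l)) f + (Σ[ t < l ] f (suc (a ∸ l) ℕ.+ t))
      ≡⟨ cong₂ _+_ (Σ<-zero (suc (a ∸ l)) below) (Σ<-cong l above) ⟩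
    0ℤ + (Σ[ t < l ] Σ[ u < l ] w a (suc (a ∸ l) ℕ.+ t) * w b u * indicator (u ≤? t))
      ≡⟨ ℤ.+-identityˡ _ ⟩
    (Σ[ t < l ] Σ[ u < l ] w a (suc (a ∸ l) ℕ.+ t) * w b u * indicator (u ≤? t)) ∎
    where
    e : ℕ → ℕ → ℤ
    e t u = w a t * w b u * violated a t u
    f : ℕ → ℤ
    f t = Σ[ u < suc b ] e t u
    e≡0 : ∀ t u → violated a t u ≡ 0ℤ → e t u ≡ 0ℤ
    e≡0 t u v≡0 = trans (cong (w a t * w b u *_) v≡0) (ℤ.*-zeroʳ (w a t * w b u))
    below : ∀ t → t < suc (a ∸ l) → f t ≡ 0ℤ
    below t t<1+a-l = Σ<-zero (suc b) λ u _ → e≡0 t u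
      (violated≡0 a (ℕ.≤-trans (ℕ.s≤s⁻¹ t<1+a-l) (ℕ.m≤n+m (a ∸ l) u)))
    l≤1+b : l ≤ suc b
    l≤1+b = ℕ.m≤n⇒m≤1+n (l≤a 2l≤b)
    above : ∀ t → t < l → f (suc (a ∸ l) ℕ.+ t) ≡ (Σ[ u < l ] w a (suc (a ∸ l) ℕ.+ t) * w b u * indicator (u ≤? t))
    above t t<l = begin
      Σ< (suc b) (e T)
        ≡⟨ cong (λ m → Σ< m (e T)) (ℕ.m+[n∸m]≡n l≤1+b) ⟨
      Σ< (l ℕ.+ (suc b ∸ l)) (e T)
        ≡⟨ Σ<-split l (suc b ∸ l) (e T) ⟩
      Σ< l (e T) + (Σ[ u < suc b ∸ l ] e T (l ℕ.+ u))
        ≡⟨ cong₂ _+_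
             (Σ<-cong l λ u _ → cong (w a T * w b u *_) (indicator-cong (u ℕ.+ (a ∸ l) <? T) (u ≤? t)
               (λ p → ℕ.+-cancelʳ-≤ (a ∸ l) u t (subst (u ℕ.+ (a ∸ l) ≤_) (ℕ.+-comm (a ∸ l) t) (ℕ.s≤s⁻¹ p)))
               (λ p → s≤s (subst (u ℕ.+ (a ∸ l) ≤_) (ℕ.+-comm t (a ∸ l)) (ℕ.+-monoˡ-≤ (a ∸ l) p)))))
             (Σ<-zero (suc b ∸ l) λ u _ → e≡0 T (l ℕ.+ u) (violated-high 2l≤a T≤a (ℕ.m≤m+n l u))) ⟩
      (Σ[ u < l ] w a T * w b u * indicator (u ≤? t)) + 0ℤ
        ≡⟨ ℤ.+-identityʳ _ ⟩
      (Σ[ u < l ] w a T * w b u * indicator (u ≤? t)) ∎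
      where
      T : ℕ
      T = suc (a ∸ l) ℕ.+ t
      T≤a : T ≤ a
      T≤a = ℕ.≤-trans (ℕ.≤-reflexive (sym (ℕ.+-suc (a ∸ l) t)))
        (ℕ.≤-trans (ℕ.+-monoʳ-≤ (a ∸ l) t<l) (ℕ.≤-reflexive (ℕ.m∸n+n≡m (l≤a 2l≤a))))

  -- At a height below l the outgoing link holds automatically, so the remaining sum decouples from
  -- t.
  path-low : ∀ {n} (a : Fin (suc n) → ℕ) → (∀ i → 2 ℕ.* l ≤ a i) → ∀ {t} z → t < l →
             path a t z ≡ w (a zero) t * pathSum⁺ a z
  path-low {zero}  a 2l≤a {t} z t<l = cong (w (a zero) t *_)
    (trans (allowed≡1-violated (a zero) t z) (cong (λ v → 1ℤ - v) (violated-low (2l≤a zero) z t<l)))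
  path-low {suc n} a 2l≤a {t} z t<l = cong (w (a zero) t *_) (Σ<-cong (suc (a (suc zero))) λ u _ →
    trans (cong (_* path (a ∘ suc) u z)
      (trans (allowed≡1-violated (a zero) t u) (cong (λ v → 1ℤ - v) (violated-low (2l≤a zero) u t<l))))
      (ℤ.*-identityˡ (path (a ∘ suc) u z)))

  -- If the first link is violated then the second is not, since the second part is
  -- then filled to less than l.
  path-step : ∀ {n} (a : Fin (suc (suc n)) → ℕ) → (∀ i → 2 ℕ.* l ≤ a i) → ∀ {t} z → t ≤ a zero →
    path a t z ≡ w (a zero) t *
      (pathSum (a ∘ suc) z - defectFrom (a zero) (a (suc zero)) t * pathSum⁺ (a ∘ suc) z)
  path-step a 2l≤a {t} z t≤a = cong (w (a zero) t *_) (begin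
    (Σ[ u < m ] allowed (a zero) t u * P u)
      ≡⟨ Σ<-cong m (λ u _ → split u) ⟩
    (Σ[ u < m ] (1ℤ * P u + - S * (w (a (suc zero)) u * violated (a zero) t u)))
      ≡⟨ Σ<-linear m 1ℤ (- S) P (λ u → w (a (suc zero)) u * violated (a zero) t u) ⟩
    1ℤ * Σ< m P + - S * defectFrom (a zero) (a (suc zero)) t
      ≡⟨ rearrange (Σ< m P) S (defectFrom (a zero) (a (suc zero)) t) ⟩
    Σ< m P - defectFrom (a zero) (a (suc zero)) t * S ∎)
    where
    m : ℕ
    m = suc (a (suc zero))
    P : ℕ → ℤ
    P u = path (a ∘ suc) u z
    S : ℤ
    S = pathSum⁺ (a ∘ suc) z
    rearrange : ∀ p s d → 1ℤ * p + - s * d ≡ p - d * s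
    rearrange = solve-∀
    low : ∀ x v s → (1ℤ - v) * (x * s) ≡ 1ℤ * (x * s) + - s * (x * v)
    low = solve-∀
    high : ∀ p s x → (1ℤ - 0ℤ) * p ≡ 1ℤ * p + - s * (x * 0ℤ)
    high = solve-∀
    split : ∀ u → allowed (a zero) t u * P u ≡
      1ℤ * P u + - S * (w (a (suc zero)) u * violated (a zero) t u)
    split u with u <? l
    -- Below l the path from u is its own weight times the constant `S`, which can leave the sum
    -- over violated links; from l on the link cannot be violated.
    ... | yes u<l = trans
      (cong₂ _*_ (allowed≡1-violated (a zero) t u) (path-low (a ∘ suc) (2l≤a ∘ suc) z u<l))
      (trans (low (w (a (suc zero)) u) (violated (a zero) t u) S)
        (cong (λ p → 1ℤ * p + - S * (w (a (suc zero)) u * violated (a zero) t u))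
          (sym (path-low (a ∘ suc) (2l≤a ∘ suc) z u<l))))
    ... | no u≮l = trans
      (cong (_* P u) (trans (allowed≡1-violated (a zero) t u) (cong (λ v → 1ℤ - v) v≡0)))
      (trans (high (P u) S (w (a (suc zero)) u))
        (cong (λ v → 1ℤ * P u + - S * (w (a (suc zero)) u * v)) (sym v≡0)))
      where
      v≡0 : violated (a zero) t u ≡ 0ℤ
      v≡0 = violated-high (2l≤a zero) t≤a (ℕ.≮⇒≥ u≮l)

  -- The target z matters only through violations of the last link, and these enter linearly; the
  -- coefficients are the two columns of the matrix product. `path-step` peels off the first part,
  -- and the second component for a longer sequence is the first component for its tail.
  pathSum-affine : ∀ {n} (a : Fin (suc n) → ℕ) → (∀ i → 2 ℕ.* l ≤ a i) → ∀ z →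
    pathSum  a z ≡ topˡ a    - defectInto (last a) z * topʳ a ×
    pathSum⁺ a z ≡ bottomˡ a - defectInto (last a) z * bottomʳ a
  pathSum-affine {zero}  a 2l≤a z = (begin
    (Σ[ t < suc a₀ ] w a₀ t * allowed a₀ t z)
      ≡⟨ Σ<-cong (suc a₀) (λ t _ → trans (cong (w a₀ t *_) (allowed≡1-violated a₀ t z)) (expand (w a₀ t) (violated a₀ t z))) ⟩
    (Σ[ t < suc a₀ ] (1ℤ * w a₀ t + - 1ℤ * (w a₀ t * violated a₀ t z)))
      ≡⟨ Σ<-linear (suc a₀) 1ℤ (- 1ℤ) (w a₀) (λ t → w a₀ t * violated a₀ t z) ⟩
    1ℤ * weight a₀ + - 1ℤ * defectInto a₀ z
      ≡⟨ collect (weight a₀) (defectInto a₀ z) ⟩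
    weight a₀ - defectInto a₀ z * 1ℤ ∎)
    , trivial (defectInto a₀ z)
    where
    a₀ : ℕ
    a₀ = a zero
    expand : ∀ x v → x * (1ℤ - v) ≡ 1ℤ * x + - 1ℤ * (x * v)
    expand = solve-∀
    collect : ∀ g d → 1ℤ * g + - 1ℤ * d ≡ g - d * 1ℤ
    collect = solve-∀
    trivial : ∀ d → 1ℤ ≡ 1ℤ - d * 0ℤ
    trivial = solve-∀
  pathSum-affine {suc n} a 2l≤a z with pathSum-affine (a ∘ suc) (2l≤a ∘ suc) z
  ... | top , bottom = (begin
    (Σ[ t < suc a₀ ] path a t z)
      ≡⟨ Σ<-cong (suc a₀) (λ t t<1+a → trans (path-step a 2l≤a z (ℕ.s≤s⁻¹ t<1+a)) (expand (w a₀ t) S (defectFrom a₀ a₁ t) S⁺)) ⟩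
    (Σ[ t < suc a₀ ] (S * w a₀ t + - S⁺ * (w a₀ t * defectFrom a₀ a₁ t)))
      ≡⟨ Σ<-linear (suc a₀) S (- S⁺) (w a₀) (λ t → w a₀ t * defectFrom a₀ a₁ t) ⟩
    S * weight a₀ + - S⁺ * (Σ[ t < suc a₀ ] w a₀ t * defectFrom a₀ a₁ t)
      ≡⟨ cong (λ v → S * weight a₀ + - S⁺ * v) (defect≡ΣdefectFrom a₀ a₁) ⟩
    S * weight a₀ + - S⁺ * defect a₀ a₁
      ≡⟨ cong₂ (λ u v → u * weight a₀ + - v * defect a₀ a₁) top bottom ⟩
    (topˡ (a ∘ suc) - I * topʳ (a ∘ suc)) * weight a₀ + - (bottomˡ (a ∘ suc) - I * bottomʳ (a ∘ suc)) * defect a₀ a₁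
      ≡⟨ collect (topˡ (a ∘ suc)) I (topʳ (a ∘ suc)) (weight a₀) (bottomˡ (a ∘ suc)) (bottomʳ (a ∘ suc)) (defect a₀ a₁) ⟩
    topˡ a - I * topʳ a ∎)
    , top
    where
    a₀ a₁ : ℕ
    a₀ = a zero
    a₁ = a (suc zero)
    S S⁺ I : ℤ
    S = pathSum (a ∘ suc) z
    S⁺ = pathSum⁺ (a ∘ suc) z
    I = defectInto (last a) z
    expand : ∀ x s d s⁺ → x * (s - d * s⁺) ≡ s * x + - s⁺ * (x * d)
    expand = solve-∀
    collect : ∀ p i q g r s d → (p - i * q) * g + - (r - i * s) * d ≡ (g * p - d * r) - i * (g * q - d * s)
    collect = solve-∀

  cycleSum : ∀ {n} → (Fin (suc n) → ℕ) → ℤ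
  cycleSum a = Σ[ t < suc (a zero) ] path a t t

  -- Closing the cycle makes the incoming and the outgoing link of the first part depend on the same
  -- height t. The mixed term vanishes: a violated incoming link requires t < l, a violated outgoing
  -- one t ≥ l. The other terms sum to the defects of the two links, and the closing defect supplies
  -- the factor left out of the right column.
  cycleSum≡trace : ∀ {n} (a : Fin (suc n) → ℕ) → (∀ i → 2 ℕ.* l ≤ a i) →
    cycleSum a ≡ topˡ a - defect (last a) (a zero) * bottomʳ a
  cycleSum≡trace {zero} a 2l≤a = begin
    (Σ[ t < suc a₀ ] w a₀ t * allowed a₀ t t)
      -- A single chain is linked to itself, and this link always holds.
      ≡⟨ Σ<-cong (suc a₀) (λ t _ → trans (cong (w a₀ t *_) (indicator-yes (t ≤? t ℕ.+ (a₀ ∸ l)) (ℕ.m≤m+n t (a₀ ∸ l)))) (ℤ.*-identityʳ (w a₀ t))) ⟩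
    weight a₀
      ≡⟨ trivial (weight a₀) (defect a₀ a₀) ⟩
    weight a₀ - defect a₀ a₀ * 0ℤ ∎
    where
    a₀ : ℕ
    a₀ = a zero
    trivial : ∀ g d → g ≡ g - d * 0ℤ
    trivial = solve-∀
  cycleSum≡trace {suc n} a 2l≤a = begin
    (Σ[ t < suc a₀ ] path a t t)
      ≡⟨ Σ<-cong (suc a₀) term ⟩
    (Σ[ t < suc a₀ ] (1ℤ * (p * w a₀ t + - q * (w a₀ t * I t)) + - r * (w a₀ t * F t)))
      ≡⟨ Σ<-linear (suc a₀) 1ℤ (- r) (λ t → p * w a₀ t + - q * (w a₀ t * I t)) (λ t → w a₀ t * F t) ⟩
    1ℤ * (Σ[ t < suc a₀ ] (p * w a₀ t + - q * (w a₀ t * I t))) + - r * (Σ[ t < suc a₀ ] w a₀ t * F t)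
      ≡⟨ cong₂ (λ u v → 1ℤ * u + - r * v) (Σ<-linear (suc a₀) p (- q) (w a₀) (λ t → w a₀ t * I t)) (defect≡ΣdefectFrom a₀ a₁) ⟩
    1ℤ * (p * weight a₀ + - q * (Σ[ t < suc a₀ ] w a₀ t * I t)) + - r * defect a₀ a₁
      ≡⟨ cong (λ u → 1ℤ * (p * weight a₀ + - q * u) + - r * defect a₀ a₁) (defect≡ΣdefectInto (last a) a₀) ⟩
    1ℤ * (p * weight a₀ + - q * defect (last a) a₀) + - r * defect a₀ a₁
      ≡⟨ collect p q r (weight a₀) (defect (last a) a₀) (defect a₀ a₁) ⟩
    topˡ a - defect (last a) a₀ * bottomʳ a ∎
    where
    a₀ a₁ : ℕ
    a₀ = a zero
    a₁ = a (suc zero)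
    p q r s : ℤ
    p = topˡ (a ∘ suc)
    q = topʳ (a ∘ suc)
    r = bottomˡ (a ∘ suc)
    s = bottomʳ (a ∘ suc)
    I F : ℕ → ℤ
    I = defectInto (last a)
    F = defectFrom a₀ a₁
    collect : ∀ p q r g d e → 1ℤ * (p * g + - q * d) + - r * e ≡ (g * p - e * r) - d * q
    collect = solve-∀
    expand-low : ∀ x p i q r s → x * (p - i * q - 0ℤ * (r - i * s)) ≡ 1ℤ * (p * x + - q * (x * i)) + - r * (x * 0ℤ)
    expand-low = solve-∀
    expand-high : ∀ x p q f r s → x * (p - 0ℤ * q - f * (r - 0ℤ * s)) ≡ 1ℤ * (p * x + - q * (x * 0ℤ)) + - r * (x * f)
    expand-high = solve-∀
    F-low : ∀ {t} → t < l → F t ≡ 0ℤ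
    F-low t<l = Σ<-zero (suc a₁) λ u _ →
      trans (cong (w a₁ u *_) (violated-low (2l≤a zero) u t<l)) (ℤ.*-zeroʳ (w a₁ u))
    I-high : ∀ {t} → l ≤ t → I t ≡ 0ℤ
    I-high l≤t = Σ<-zero (suc (last a)) λ v v<1+a →
      trans (cong (w (last a) v *_) (violated-high (2l≤a (fromℕ (suc n))) (ℕ.s≤s⁻¹ v<1+a) l≤t)) (ℤ.*-zeroʳ (w (last a) v))
    term : ∀ t → t < suc a₀ → path a t t ≡ 1ℤ * (p * w a₀ t + - q * (w a₀ t * I t)) + - r * (w a₀ t * F t)
    term t t<1+a = trans (path-step a 2l≤a t (ℕ.s≤s⁻¹ t<1+a))
      (trans (cong₂ (λ u v → w a₀ t * (u - F t * v)) (proj₁ affine) (proj₂ affine)) expand)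
      where
      affine : pathSum (a ∘ suc) t ≡ p - I t * q × pathSum⁺ (a ∘ suc) t ≡ r - I t * s
      affine = pathSum-affine (a ∘ suc) (2l≤a ∘ suc) t
      expand : w a₀ t * (p - I t * q - F t * (r - I t * s)) ≡
               1ℤ * (p * w a₀ t + - q * (w a₀ t * I t)) + - r * (w a₀ t * F t)
      expand with t <? l
      ... | yes t<l = subst
        (λ f → w a₀ t * (p - I t * q - f * (r - I t * s)) ≡ 1ℤ * (p * w a₀ t + - q * (w a₀ t * I t)) + - r * (w a₀ t * f))
        (sym (F-low t<l)) (expand-low (w a₀ t) p (I t) q r s)
      ... | no t≮l = subst
        (λ i → w a₀ t * (p - i * q - F t * (r - i * s)) ≡ 1ℤ * (p * w a₀ t + - q * (w a₀ t * i)) + - r * (w a₀ t * F t))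
        (sym (I-high (ℕ.≮⇒≥ t≮l))) (expand-high (w a₀ t) p q (F t) r s)

-- Reversing the weights

geometric-sum : ∀ q n → (1ℤ - q) * (Σ[ t < n ] q ^ t) + q ^ n ≡ 1ℤ
geometric-sum q zero    = trans (cong (_+ 1ℤ) (ℤ.*-zeroʳ (1ℤ - q))) refl
geometric-sum q (suc n) = begin
  (1ℤ - q) * (1ℤ + (Σ[ t < n ] q * q ^ t)) + q * q ^ n
    ≡⟨ cong (λ v → (1ℤ - q) * (1ℤ + v) + q * q ^ n) (Σ<-*ˡ n q (q ^_)) ⟩
  (1ℤ - q) * (1ℤ + q * S) + q * q ^ n
    ≡⟨ rearrange q S (q ^ n) ⟩
  1ℤ - q + q * ((1ℤ - q) * S + q ^ n)
    ≡⟨ cong (λ v → 1ℤ - q + q * v) (geometric-sum q n) ⟩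
  1ℤ - q + q * 1ℤ
    ≡⟨ cancel q ⟩
  1ℤ ∎
  where
  S : ℤ
  S = Σ[ t < n ] q ^ t
  rearrange : ∀ q s p → (1ℤ - q) * (1ℤ + q * s) + q * p ≡ 1ℤ - q + q * ((1ℤ - q) * s + p)
  rearrange = solve-∀
  cancel : ∀ q → 1ℤ - q + q * 1ℤ ≡ 1ℤ
  cancel = solve-∀

module Evaluated (l : ℕ) (q : ℤ) where

  -- The first counts the elements of an ideal in a chain, the second those outside it; the second
  -- therefore produces the reversed polynomial.
  ascending descending : ℕ → ℕ → ℤ
  ascending  a t = q ^ t
  descending a t = q ^ (a ∸ t)

  module ↑ = Cycle l ascending
  module ↓ = Cycle l descending

  weight-descending : ∀ a → ↓.weight a ≡ ↑.weight a
  weight-descending a = sym (Σ<-reverse (suc a) (q ^_))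

  x : ℕ → ℤ
  x a = q ^ suc (a ∸ l)

  W : ℤ
  W = Σ[ t < l ] Σ[ u < l ] q ^ t * q ^ u * indicator (u ≤? t)

  weight-geometric : ∀ {a} → 2 ℕ.* l ≤ a → (1ℤ - q) * ↑.weight a + q ^ l * x a ≡ 1ℤ
  weight-geometric {a} 2l≤a = begin
    (1ℤ - q) * ↑.weight a + q ^ l * q ^ suc (a ∸ l)  ≡⟨ cong (λ v → (1ℤ - q) * ↑.weight a + v) (ℤ.^-distribˡ-+-* q l (suc (a ∸ l))) ⟨
    (1ℤ - q) * ↑.weight a + q ^ (l ℕ.+ suc (a ∸ l))  ≡⟨ cong (λ n → (1ℤ - q) * ↑.weight a + q ^ n)
                                                          (trans (ℕ.+-suc l (a ∸ l)) (cong suc (ℕ.m+[n∸m]≡n (↑.l≤a 2l≤a)))) ⟩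
    (1ℤ - q) * ↑.weight a + q ^ suc a                ≡⟨ geometric-sum q (suc a) ⟩
    1ℤ                                               ∎

  -- The shift of the first height by a - l + 1 contributes the power `x a`, so the first chain of
  -- the link determines the factor.
  defect-ascending : ∀ {a b} → 2 ℕ.* l ≤ a → 2 ℕ.* l ≤ b → ↑.defect a b ≡ x a * W
  defect-ascending {a} {b} 2l≤a 2l≤b = begin
    ↑.defect a b
      ≡⟨ ↑.defect-overlap a b 2l≤a 2l≤b ⟩
    (Σ[ t < l ] Σ[ u < l ] q ^ (suc (a ∸ l) ℕ.+ t) * q ^ u * indicator (u ≤? t))
      ≡⟨ Σ<-cong l (λ t _ → trans (Σ<-cong l λ u _ → trans
           (cong (λ v → v * q ^ u * indicator (u ≤? t)) (ℤ.^-distribˡ-+-* q (suc (a ∸ l)) t))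
           (assoc (x a) (q ^ t) (q ^ u) (indicator (u ≤? t))))
           (Σ<-*ˡ l (x a) (λ u → q ^ t * q ^ u * indicator (u ≤? t)))) ⟩
    (Σ[ t < l ] x a * (Σ[ u < l ] q ^ t * q ^ u * indicator (u ≤? t)))
      ≡⟨ Σ<-*ˡ l (x a) (λ t → Σ[ u < l ] q ^ t * q ^ u * indicator (u ≤? t)) ⟩
    x a * W ∎
    where
    assoc : ∀ x p r i → x * p * r * i ≡ x * (p * r * i)
    assoc = solve-∀

  -- Reversing both ranges turns `u ≤ t` around; exchanging the two summations restores it.
  W-reverse : W ≡ (Σ[ t < l ] Σ[ u < l ] q ^ (l ∸ suc t) * q ^ (l ∸ suc u) * indicator (u ≤? t))
  W-reverse = begin
    W
      ≡⟨ Σ<-reverse l (λ t → Σ[ u < l ] q ^ t * q ^ u * indicator (u ≤? t)) ⟩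
    (Σ[ t < l ] Σ[ u < l ] q ^ (l ∸ suc t) * q ^ u * indicator (u ≤? l ∸ suc t))
      ≡⟨ Σ<-cong l (λ t t<l → trans (Σ<-reverse l (λ u → q ^ (l ∸ suc t) * q ^ u * indicator (u ≤? l ∸ suc t)))
           (Σ<-cong l λ u u<l → cong₂ _*_ (ℤ.*-comm (q ^ (l ∸ suc t)) (q ^ (l ∸ suc u)))
             (indicator-cong (l ∸ suc u ≤? l ∸ suc t) (t ≤? u)
               (λ p → ℕ.s≤s⁻¹ (ℕ.∸-cancelʳ-≤ t<l p))
               (λ p → ℕ.∸-monoʳ-≤ l (s≤s p))))) ⟩
    (Σ[ t < l ] Σ[ u < l ] q ^ (l ∸ suc u) * q ^ (l ∸ suc t) * indicator (t ≤? u))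
      ≡⟨ Σ<-comm l l (λ t u → q ^ (l ∸ suc u) * q ^ (l ∸ suc t) * indicator (t ≤? u)) ⟩
    (Σ[ t < l ] Σ[ u < l ] q ^ (l ∸ suc t) * q ^ (l ∸ suc u) * indicator (u ≤? t)) ∎

  -- Outside the ideal there are l - 1 - t elements of the first chain and (b - l + 1) + (l - 1 - u)
  -- of the second. The power that comes out is therefore that of the second chain of the link,
  -- unlike in the ascending case.
  defect-descending : ∀ {a b} → 2 ℕ.* l ≤ a → 2 ℕ.* l ≤ b → ↓.defect a b ≡ W * x b
  defect-descending {a} {b} 2l≤a 2l≤b = begin
    ↓.defect a b
      ≡⟨ ↓.defect-overlap a b 2l≤a 2l≤b ⟩
    (Σ[ t < l ] Σ[ u < l ] q ^ (a ∸ (suc (a ∸ l) ℕ.+ t)) * q ^ (b ∸ u) * indicator (u ≤? t))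
      ≡⟨ Σ<-cong l (λ t _ → trans (Σ<-cong l λ u u<l → trans
           (cong₂ (λ v w → v * w * indicator (u ≤? t)) (cong (q ^_) (upper t))
             (trans (cong (q ^_) (lower u u<l)) (ℤ.^-distribˡ-+-* q (suc (b ∸ l)) (l ∸ suc u))))
           (assoc (x b) (q ^ (l ∸ suc t)) (q ^ (l ∸ suc u)) (indicator (u ≤? t))))
           (Σ<-*ʳ l (x b) (λ u → q ^ (l ∸ suc t) * q ^ (l ∸ suc u) * indicator (u ≤? t)))) ⟩
    (Σ[ t < l ] (Σ[ u < l ] q ^ (l ∸ suc t) * q ^ (l ∸ suc u) * indicator (u ≤? t)) * x b)
      ≡⟨ Σ<-*ʳ l (x b) (λ t → Σ[ u < l ] q ^ (l ∸ suc t) * q ^ (l ∸ suc u) * indicator (u ≤? t)) ⟩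
    (Σ[ t < l ] Σ[ u < l ] q ^ (l ∸ suc t) * q ^ (l ∸ suc u) * indicator (u ≤? t)) * x b
      ≡⟨ cong (_* x b) W-reverse ⟨
    W * x b ∎
    where
    assoc : ∀ x p r i → p * (x * r) * i ≡ p * r * i * x
    assoc = solve-∀
    upper : ∀ t → a ∸ (suc (a ∸ l) ℕ.+ t) ≡ l ∸ suc t
    upper t = begin
      a ∸ (suc (a ∸ l) ℕ.+ t)                ≡⟨ cong (a ∸_) (ℕ.+-suc (a ∸ l) t) ⟨
      a ∸ (a ∸ l ℕ.+ suc t)                  ≡⟨ ℕ.∸-+-assoc a (a ∸ l) (suc t) ⟨
      a ∸ (a ∸ l) ∸ suc t                    ≡⟨ cong (_∸ suc t) (ℕ.m∸[m∸n]≡n (↑.l≤a 2l≤a)) ⟩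
      l ∸ suc t                              ∎
    lower : ∀ u → u < l → b ∸ u ≡ suc (b ∸ l) ℕ.+ (l ∸ suc u)
    lower u u<l = begin
      b ∸ u                                  ≡⟨ cong (_∸ u) (ℕ.m∸n+n≡m (↑.l≤a 2l≤b)) ⟨
      b ∸ l ℕ.+ l ∸ u                        ≡⟨ ℕ.+-∸-assoc (b ∸ l) (ℕ.<⇒≤ u<l) ⟩
      b ∸ l ℕ.+ (l ∸ u)                      ≡⟨ cong (b ∸ l ℕ.+_) (ℕ.+-∸-assoc 1 u<l) ⟩
      b ∸ l ℕ.+ suc (l ∸ suc u)              ≡⟨ ℕ.+-suc (b ∸ l) (l ∸ suc u) ⟩
      suc (b ∸ l) ℕ.+ (l ∸ suc u)            ∎

  -- A descending factor is [[g , - W] , [1 , 0]] times diag(1 , x) for the following chain.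
  -- Regrouping each diagonal matrix with the factor after it gives [[g , - W] , [x , 0]]; hence
  -- `x (a zero)` multiplies the bottom row. The right columns receive the closing factor that
  -- `topʳ` and `bottomʳ` omit.
  intertwined-products : ∀ {n} (a : Fin (suc n) → ℕ) → (∀ i → 2 ℕ.* l ≤ a i) →
    Intertwined (1ℤ - q) (q ^ l) W
      (↑.topˡ a) (- (x (↑.last a) * W * ↑.topʳ a)) (↑.bottomˡ a) (- (x (↑.last a) * W * ↑.bottomʳ a))
      (↓.topˡ a) (- (W * ↓.topʳ a)) (x (a zero) * ↓.bottomˡ a) (- (W * (x (a zero) * ↓.bottomʳ a)))
  intertwined-products {zero} a 2l≤a = intertwined-cong
    refl refl refl refl (sym (weight-descending (a zero))) refl refl refl
    (intertwined-base (↑.weight (a zero)) (x (a zero)) (weight-geometric (2l≤a zero)))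
  intertwined-products {suc n} a 2l≤a = intertwined-cong
    (cong (λ d → g * ↑.topˡ a⁺ - d * ↑.bottomˡ a⁺) d↑)
    (trans (m₂ g (x (a zero)) y W (↑.topʳ a⁺) (↑.bottomʳ a⁺))
      (cong (λ d → - (y * W * (g * ↑.topʳ a⁺ - d * ↑.bottomʳ a⁺))) d↑))
    refl
    refl
    (trans (n₁ g W (↓.topˡ a⁺) (x (a (suc zero))) (↓.bottomˡ a⁺))
      (cong₂ (λ g d → g * ↓.topˡ a⁺ - d * ↓.bottomˡ a⁺) g↓ d↓))
    (trans (n₂ g W (↓.topʳ a⁺) (x (a (suc zero))) (↓.bottomʳ a⁺))
      (cong₂ (λ g d → - (W * (g * ↓.topʳ a⁺ - d * ↓.bottomʳ a⁺))) g↓ d↓))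
    refl
    (n₄ W (x (a zero)) (↓.topʳ a⁺))
    (intertwined-step g (x (a zero)) (weight-geometric (2l≤a zero)) (intertwined-products a⁺ (2l≤a ∘ suc)))
    where
    a⁺ : Fin (suc n) → ℕ
    a⁺ = a ∘ suc
    g y : ℤ
    g = ↑.weight (a zero)
    y = x (↑.last a)
    g↓ : g ≡ ↓.weight (a zero)
    g↓ = sym (weight-descending (a zero))
    d↑ : x (a zero) * W ≡ ↑.defect (a zero) (a (suc zero))
    d↑ = sym (defect-ascending (2l≤a zero) (2l≤a (suc zero)))
    d↓ : W * x (a (suc zero)) ≡ ↓.defect (a zero) (a (suc zero))
    d↓ = sym (defect-descending (2l≤a zero) (2l≤a (suc zero)))
    m₂ : ∀ g x y W t b → g * (- (y * W * t)) - x * W * (- (y * W * b)) ≡ - (y * W * (g * t - x * W * b))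
    m₂ = solve-∀
    n₁ : ∀ g W t x b → g * t - W * (x * b) ≡ g * t - W * x * b
    n₁ = solve-∀
    n₂ : ∀ g W t x b → g * (- (W * t)) - W * (- (W * (x * b))) ≡ - (W * (g * t - W * x * b))
    n₂ = solve-∀
    n₄ : ∀ W x t → x * (- (W * t)) ≡ - (W * (x * t))
    n₄ = solve-∀

  cycleSum-reverse : ∀ {n} (a : Fin (suc n) → ℕ) → (∀ i → 2 ℕ.* l ≤ a i) → ↑.cycleSum a ≡ ↓.cycleSum a
  cycleSum-reverse {n} a 2l≤a = begin
    ↑.cycleSum a
      ≡⟨ ↑.cycleSum≡trace a 2l≤a ⟩
    ↑.topˡ a - ↑.defect (↑.last a) (a zero) * ↑.bottomʳ a
      ≡⟨ cong (λ v → ↑.topˡ a - v * ↑.bottomʳ a) (defect-ascending (2l≤a (fromℕ n)) (2l≤a zero)) ⟩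
    ↑.topˡ a - x (↑.last a) * W * ↑.bottomʳ a
      ≡⟨ intertwined⇒trace≡ (intertwined-products a 2l≤a) ⟩
    ↓.topˡ a - W * (x (a zero) * ↓.bottomʳ a)
      ≡⟨ cong (λ v → ↓.topˡ a - v) (ℤ.*-assoc W (x (a zero)) (↓.bottomʳ a)) ⟨
    ↓.topˡ a - W * x (a zero) * ↓.bottomʳ a
      ≡⟨ cong (λ v → ↓.topˡ a - v * ↓.bottomʳ a) (defect-descending (2l≤a (fromℕ n)) (2l≤a zero)) ⟨
    ↓.topˡ a - ↓.defect (↓.last a) (a zero) * ↓.bottomʳ a
      ≡⟨ ↓.cycleSum≡trace a 2l≤a ⟨
    ↓.cycleSum a ∎

-- From subsets to fillings

ΣList : ∀ {A : Set} → List A → (A → ℤ) → ℤ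
ΣList xs F = List.foldr (λ x v → F x + v) 0ℤ xs

ΣList-++ : ∀ {A : Set} (xs ys : List A) F → ΣList (xs List.++ ys) F ≡ ΣList xs F + ΣList ys F
ΣList-++ []       ys F = sym (ℤ.+-identityˡ _)
ΣList-++ (x ∷ xs) ys F = trans (cong (λ v → F x + v) (ΣList-++ xs ys F)) (sym (ℤ.+-assoc (F x) _ _))

ΣList-map : ∀ {A B : Set} (f : A → B) xs F → ΣList (List.map f xs) F ≡ ΣList xs (F ∘ f)
ΣList-map f []       F = refl
ΣList-map f (x ∷ xs) F = cong (λ v → F (f x) + v) (ΣList-map f xs F)

ΣList-cong : ∀ {A : Set} (xs : List A) {F G : A → ℤ} → (∀ x → F x ≡ G x) → ΣList xs F ≡ ΣList xs G
ΣList-cong []       F≡G = refl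
ΣList-cong (x ∷ xs) F≡G = cong₂ _+_ (F≡G x) (ΣList-cong xs F≡G)

ΣList-zero : ∀ {A : Set} (xs : List A) → ΣList xs (λ _ → 0ℤ) ≡ 0ℤ
ΣList-zero []       = refl
ΣList-zero (x ∷ xs) = trans (ℤ.+-identityˡ _) (ΣList-zero xs)

ΣList-*ˡ : ∀ {A : Set} c (xs : List A) F → ΣList xs (λ x → c * F x) ≡ c * ΣList xs F
ΣList-*ˡ c []       F = sym (ℤ.*-zeroʳ c)
ΣList-*ˡ c (x ∷ xs) F = trans (cong (λ v → c * F x + v) (ΣList-*ˡ c xs F)) (sym (ℤ.*-distribˡ-+ c (F x) (ΣList xs F)))

eval-∑-filter : ∀ {A : Set} {P : Pred A _} (P? : Decidable P) q (f : A → ℕ) xs →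
  eval q (∑ (List.map (λ x → q^ f x) (List.filter P? xs))) ≡ ΣList xs (λ x → indicator (P? x) * q ^ f x)
eval-∑-filter P? q f []       = refl
eval-∑-filter P? q f (x ∷ xs) with P? x
... | yes _ = trans (eval-⊕ q (q^ f x) (∑ (List.map (λ x → q^ f x) (List.filter P? xs))))
                (cong₂ _+_ (trans (eval-q^ q (f x)) (sym (ℤ.*-identityˡ (q ^ f x)))) (eval-∑-filter P? q f xs))
... | no _  = trans (eval-∑-filter P? q f xs) (sym (ℤ.+-identityˡ _))

ΣSubset : ∀ n → (Subset n → ℤ) → ℤ
ΣSubset n = ΣList (subsets n)

ΣSubset-suc : ∀ n F → ΣSubset (suc n) F ≡ ΣSubset n (F ∘ (outside ∷_)) + ΣSubset n (F ∘ (inside ∷_))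
ΣSubset-suc n F = trans (ΣList-++ (List.map (outside ∷_) (subsets n)) _ F)
  (cong₂ _+_ (ΣList-map (outside ∷_) (subsets n) F) (ΣList-map (inside ∷_) (subsets n) F))

ΣSubset-+ : ∀ m n F → ΣSubset (m ℕ.+ n) F ≡ ΣSubset m (λ J → ΣSubset n (λ K → F (J Vec.++ K)))
ΣSubset-+ zero    n F = sym (ℤ.+-identityʳ _)
ΣSubset-+ (suc m) n F = begin
  ΣSubset (suc m ℕ.+ n) F
    ≡⟨ ΣSubset-suc (m ℕ.+ n) F ⟩
  ΣSubset (m ℕ.+ n) (F ∘ (outside ∷_)) + ΣSubset (m ℕ.+ n) (F ∘ (inside ∷_))
    ≡⟨ cong₂ _+_ (ΣSubset-+ m n (F ∘ (outside ∷_))) (ΣSubset-+ m n (F ∘ (inside ∷_))) ⟩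
  ΣSubset m (λ J → ΣSubset n (λ K → F (outside ∷ J Vec.++ K))) + ΣSubset m (λ J → ΣSubset n (λ K → F (inside ∷ J Vec.++ K)))
    ≡⟨ ΣSubset-suc m (λ J → ΣSubset n (λ K → F (J Vec.++ K))) ⟨
  ΣSubset (suc m) (λ J → ΣSubset n (λ K → F (J Vec.++ K))) ∎

-- Initial segments and filled subsets

Initial : ∀ {n} → Subset n → Set
Initial []            = ⊤
Initial (inside  ∷ J) = Initial J
Initial (outside ∷ J) = ∣ J ∣ ≡ 0

initial? : ∀ {n} (J : Subset n) → Dec (Initial J)
initial? []            = yes tt
initial? (inside  ∷ J) = initial? J
initial? (outside ∷ J) = ∣ J ∣ ℕ.≟ 0

ΣSubset-empty : ∀ n (H : ℕ → ℤ) → ΣSubset n (λ J → indicator (∣ J ∣ ℕ.≟ 0) * H ∣ J ∣) ≡ H 0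
ΣSubset-empty zero    H = trans (ℤ.+-identityʳ _) (ℤ.*-identityˡ (H 0))
ΣSubset-empty (suc n) H = begin
  ΣSubset (suc n) (λ J → indicator (∣ J ∣ ℕ.≟ 0) * H ∣ J ∣)
    ≡⟨ ΣSubset-suc n (λ J → indicator (∣ J ∣ ℕ.≟ 0) * H ∣ J ∣) ⟩
  ΣSubset n (λ J → indicator (∣ J ∣ ℕ.≟ 0) * H ∣ J ∣) + ΣSubset n (λ J → 0ℤ * H (suc ∣ J ∣))
    ≡⟨ cong₂ _+_ (ΣSubset-empty n H) (trans (ΣList-cong (subsets n) (λ J → ℤ.*-zeroˡ (H (suc ∣ J ∣)))) (ΣList-zero (subsets n))) ⟩
  H 0 + 0ℤ
    ≡⟨ ℤ.+-identityʳ (H 0) ⟩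
  H 0 ∎

-- There is exactly one initial segment of each size: without the first index it is empty, and with
-- it the rest is again initial.
ΣSubset-initial : ∀ n (H : ℕ → ℤ) → ΣSubset n (λ J → indicator (initial? J) * H ∣ J ∣) ≡ (Σ[ t < suc n ] H t)
ΣSubset-initial zero    H = cong (_+ 0ℤ) (ℤ.*-identityˡ (H 0))
ΣSubset-initial (suc n) H = trans (ΣSubset-suc n (λ J → indicator (initial? J) * H ∣ J ∣))
  (cong₂ _+_ (ΣSubset-empty n H) (ΣSubset-initial n (H ∘ suc)))

ΣVec : ∀ {s} → (Fin s → ℕ) → (Vec ℕ s → ℤ) → ℤ
ΣVec {zero}  a H = H []
ΣVec {suc s} a H = Σ[ t < suc (a zero) ] ΣVec (a ∘ suc) (λ c → H (t ∷ c))

ΣVec-cong : ∀ {s} (a : Fin s → ℕ) {G H : Vec ℕ s → ℤ} → (∀ c → G c ≡ H c) → ΣVec a G ≡ ΣVec a H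
ΣVec-cong {zero}  a G≡H = G≡H []
ΣVec-cong {suc s} a G≡H = Σ<-cong (suc (a zero)) (λ t _ → ΣVec-cong (a ∘ suc) (λ c → G≡H (t ∷ c)))

ΣVec-*ˡ : ∀ {s} (a : Fin s → ℕ) k (H : Vec ℕ s → ℤ) → ΣVec a (λ c → k * H c) ≡ k * ΣVec a H
ΣVec-*ˡ {zero}  a k H = refl
ΣVec-*ˡ {suc s} a k H = trans (Σ<-cong (suc (a zero)) (λ t _ → ΣVec-*ˡ (a ∘ suc) k (λ c → H (t ∷ c))))
  (Σ<-*ˡ (suc (a zero)) k (λ t → ΣVec (a ∘ suc) (λ c → H (t ∷ c))))

take-++ : ∀ {A : Set} {m n} (xs : Vec A m) (ys : Vec A n) → take m (xs Vec.++ ys) ≡ xs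
take-++ []       ys = refl
take-++ (x ∷ xs) ys = cong (x ∷_) (take-++ xs ys)

drop-++ : ∀ {A : Set} {m n} (xs : Vec A m) (ys : Vec A n) → drop m (xs Vec.++ ys) ≡ ys
drop-++ []       ys = refl
drop-++ (x ∷ xs) ys = drop-++ xs ys

∣++∣ : ∀ {m n} (J : Subset m) (K : Subset n) → ∣ J Vec.++ K ∣ ≡ ∣ J ∣ ℕ.+ ∣ K ∣
∣++∣ []            K = refl
∣++∣ (inside  ∷ J) K = cong suc (∣++∣ J K)
∣++∣ (outside ∷ J) K = ∣++∣ J K

∣take∣+∣drop∣ : ∀ m {n} (I : Subset (m ℕ.+ n)) → ∣ I ∣ ≡ ∣ take m I ∣ ℕ.+ ∣ drop m I ∣
∣take∣+∣drop∣ m I = trans (cong ∣_∣ (sym (take++drop≡id m I))) (∣++∣ (take m I) (drop m I))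

-- `enumerateΣ` lists the elements chain after chain, so `take` and `drop` separate the first chain
-- from the others.
counts : ∀ {s} (a : Fin s → ℕ) → Subset (total a) → Vec ℕ s
counts {zero}  a I = []
counts {suc s} a I = ∣ take (a zero) I ∣ ∷ counts (a ∘ suc) (drop (a zero) I)

Filled : ∀ {s} (a : Fin s → ℕ) → Subset (total a) → Set
Filled {zero}  a I = ⊤
Filled {suc s} a I = Initial (take (a zero) I) × Filled (a ∘ suc) (drop (a zero) I)

filled? : ∀ {s} (a : Fin s → ℕ) (I : Subset (total a)) → Dec (Filled a I)
filled? {zero}  a I = yes tt
filled? {suc s} a I = initial? (take (a zero) I) ×-dec filled? (a ∘ suc) (drop (a zero) I)

-- A filled subset is determined by its heights, and all heights up to the parts occur
-- independently.
ΣSubset-filled : ∀ {s} (a : Fin s → ℕ) (H : Vec ℕ s → ℤ) →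
  ΣSubset (total a) (λ I → indicator (filled? a I) * H (counts a I)) ≡ ΣVec a H
ΣSubset-filled {zero}  a H = trans (ℤ.+-identityʳ _) (ℤ.*-identityˡ (H []))
ΣSubset-filled {suc s} a H = begin
  ΣSubset (a zero ℕ.+ total (a ∘ suc)) (λ I → indicator (filled? a I) * H (counts a I))
    ≡⟨ ΣSubset-+ (a zero) (total (a ∘ suc)) (λ I → indicator (filled? a I) * H (counts a I)) ⟩
  ΣSubset (a zero) (λ J → ΣSubset (total (a ∘ suc)) (λ K → indicator (filled? a (J Vec.++ K)) * H (counts a (J Vec.++ K))))
    ≡⟨ ΣList-cong (subsets (a zero)) (λ J → trans (ΣList-cong (subsets (total (a ∘ suc))) (separate J))
         (ΣList-*ˡ (indicator (initial? J)) (subsets (total (a ∘ suc)))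
           (λ K → indicator (filled? (a ∘ suc) K) * H (∣ J ∣ ∷ counts (a ∘ suc) K)))) ⟩
  ΣSubset (a zero) (λ J → indicator (initial? J) *
    ΣSubset (total (a ∘ suc)) (λ K → indicator (filled? (a ∘ suc) K) * H (∣ J ∣ ∷ counts (a ∘ suc) K)))
    ≡⟨ ΣList-cong (subsets (a zero)) (λ J → cong (indicator (initial? J) *_) (ΣSubset-filled (a ∘ suc) (λ c → H (∣ J ∣ ∷ c)))) ⟩
  ΣSubset (a zero) (λ J → indicator (initial? J) * ΣVec (a ∘ suc) (λ c → H (∣ J ∣ ∷ c)))
    ≡⟨ ΣSubset-initial (a zero) (λ t → ΣVec (a ∘ suc) (λ c → H (t ∷ c))) ⟩
  ΣVec a H ∎
  where
  separate : ∀ J K → indicator (filled? a (J Vec.++ K)) * H (counts a (J Vec.++ K)) ≡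
    indicator (initial? J) * (indicator (filled? (a ∘ suc) K) * H (∣ J ∣ ∷ counts (a ∘ suc) K))
  separate J K rewrite take-++ J K | drop-++ J K | indicator-× (initial? J) (filled? (a ∘ suc) K) =
    ℤ.*-assoc (indicator (initial? J)) (indicator (filled? (a ∘ suc) K)) (H (∣ J ∣ ∷ counts (a ∘ suc) K))

-- The target z of the last link is left open for the recursion along the vector; the cycle is
-- closed later by setting z to the head.
Linked : ∀ {n} → ℕ → (Fin (suc n) → ℕ) → Vec ℕ (suc n) → ℕ → Set
Linked {zero}  l a (t ∷ [])    z = t ≤ z ℕ.+ (a zero ∸ l)
Linked {suc n} l a (t ∷ u ∷ c) z = t ≤ u ℕ.+ (a zero ∸ l) × Linked l (a ∘ suc) (u ∷ c) z

linked? : ∀ {n} l (a : Fin (suc n) → ℕ) c z → Dec (Linked l a c z)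
linked? {zero}  l a (t ∷ [])    z = t ≤? z ℕ.+ (a zero ∸ l)
linked? {suc n} l a (t ∷ u ∷ c) z = (t ≤? u ℕ.+ (a zero ∸ l)) ×-dec linked? l (a ∘ suc) (u ∷ c) z

linked⇒ : ∀ {n} l (a : Fin (suc n) → ℕ) c z → Linked l a c z →
          ∀ i → lookup c i ≤ lookup (tail c ∷ʳ z) i ℕ.+ (a i ∸ l)
linked⇒ {zero}  l a (t ∷ [])    z p       zero    = p
linked⇒ {suc n} l a (t ∷ u ∷ c) z (p , _) zero    = p
linked⇒ {suc n} l a (t ∷ u ∷ c) z (_ , p) (suc i) = linked⇒ l (a ∘ suc) (u ∷ c) z p i

⇒linked : ∀ {n} l (a : Fin (suc n) → ℕ) c z →
          (∀ i → lookup c i ≤ lookup (tail c ∷ʳ z) i ℕ.+ (a i ∸ l)) → Linked l a c z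
⇒linked {zero}  l a (t ∷ [])    z p = p zero
⇒linked {suc n} l a (t ∷ u ∷ c) z p = p zero , ⇒linked l (a ∘ suc) (u ∷ c) z (p ∘ suc)

cyclicSuc-fromℕ : ∀ n {{_ : NonZero (suc n)}} → cyclicSuc (fromℕ n) ≡ zero
cyclicSuc-fromℕ n = Fin.toℕ-injective (begin
  toℕ (cyclicSuc (fromℕ n))  ≡⟨ Fin.toℕ-fromℕ< (m%n<n (suc (toℕ (fromℕ n))) (suc n)) ⟩
  suc (toℕ (fromℕ n)) % suc n ≡⟨ cong (λ m → suc m % suc n) (Fin.toℕ-fromℕ n) ⟩
  suc n % suc n              ≡⟨ n%n≡0 (suc n) ⟩
  0                          ∎)

cyclicSuc-inject₁ : ∀ {n} {{_ : NonZero (suc n)}} (i : Fin n) → cyclicSuc (inject₁ i) ≡ suc i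
cyclicSuc-inject₁ {n} i = Fin.toℕ-injective (begin
  toℕ (cyclicSuc (inject₁ i))  ≡⟨ Fin.toℕ-fromℕ< (m%n<n (suc (toℕ (inject₁ i))) (suc n)) ⟩
  suc (toℕ (inject₁ i)) % suc n ≡⟨ cong (λ m → suc m % suc n) (Fin.toℕ-inject₁ i) ⟩
  suc (toℕ i) % suc n          ≡⟨ m<n⇒m%n≡m (s≤s (Fin.toℕ<n i)) ⟩
  suc (toℕ i)                  ∎)

lookup-∷ʳ-fromℕ : ∀ {A : Set} {n} (xs : Vec A n) x → lookup (xs ∷ʳ x) (fromℕ n) ≡ x
lookup-∷ʳ-fromℕ []       x = refl
lookup-∷ʳ-fromℕ (y ∷ xs) x = lookup-∷ʳ-fromℕ xs x

lookup-∷ʳ-inject₁ : ∀ {A : Set} {n} (xs : Vec A n) x i → lookup (xs ∷ʳ x) (inject₁ i) ≡ lookup xs i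
lookup-∷ʳ-inject₁ (y ∷ xs) x zero    = refl
lookup-∷ʳ-inject₁ (y ∷ xs) x (suc i) = lookup-∷ʳ-inject₁ xs x i

-- Connects the recursive link conditions, which refer to the following entry, with the modular
-- successor in the order of the poset.
lookup-rotate : ∀ {A : Set} {n} {{_ : NonZero (suc n)}} (xs : Vec A (suc n)) i →
  lookup (tail xs ∷ʳ head xs) i ≡ lookup xs (cyclicSuc i)
lookup-rotate {n = n} xs@(x ∷ ys) i with view i
... | ‵fromℕ     = trans (lookup-∷ʳ-fromℕ ys x) (cong (lookup xs) (sym (cyclicSuc-fromℕ n)))
... | ‵inject₁ j = trans (lookup-∷ʳ-inject₁ ys x j) (cong (lookup xs) (sym (cyclicSuc-inject₁ j)))

-- Membership in terms of heights

member⇒∣∣≢0 : ∀ {n} (J : Subset n) j → lookup J j ≡ inside → ∣ J ∣ ≢ 0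
member⇒∣∣≢0 (inside  ∷ J) j       _ ()
member⇒∣∣≢0 (outside ∷ J) (suc j) p e = member⇒∣∣≢0 J j p e

initial⇒member⇒< : ∀ {n} (J : Subset n) → Initial J → ∀ j → lookup J j ≡ inside → toℕ j < ∣ J ∣
initial⇒member⇒< (inside  ∷ J) p zero    _ = s≤s z≤n
initial⇒member⇒< (inside  ∷ J) p (suc j) q = s≤s (initial⇒member⇒< J p j q)
initial⇒member⇒< (outside ∷ J) p (suc j) q = contradiction p (member⇒∣∣≢0 J j q)

initial⇒<⇒member : ∀ {n} (J : Subset n) → Initial J → ∀ j → toℕ j < ∣ J ∣ → lookup J j ≡ inside
initial⇒<⇒member (inside  ∷ J) p zero    _       = refl
initial⇒<⇒member (inside  ∷ J) p (suc j) (s≤s q) = initial⇒<⇒member J p j q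
initial⇒<⇒member (outside ∷ J) p j       q       = contradiction (subst (toℕ j <_) p q) λ ()

no-members⇒∣∣≡0 : ∀ {n} (J : Subset n) → (∀ j → lookup J j ≢ inside) → ∣ J ∣ ≡ 0
no-members⇒∣∣≡0 []            p = refl
no-members⇒∣∣≡0 (inside  ∷ J) p = contradiction refl (p zero)
no-members⇒∣∣≡0 (outside ∷ J) p = no-members⇒∣∣≡0 J (p ∘ suc)

closed⇒initial : ∀ {n} (J : Subset n) →
  (∀ j k → toℕ k ≤ toℕ j → lookup J j ≡ inside → lookup J k ≡ inside) → Initial J
closed⇒initial []            p = tt
closed⇒initial (inside  ∷ J) p = closed⇒initial J (λ j k k≤j → p (suc j) (suc k) (s≤s k≤j))
-- Any later member would force the missing first index to be a member.
closed⇒initial (outside ∷ J) p = no-members⇒∣∣≡0 J λ j q → contradiction (p (suc j) zero z≤n q) λ ()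

index : ∀ {s} (a : Fin s → ℕ) → (Σ[ i ∈ Fin s ] Fin (a i)) → Fin (total a)
index a = Inverse.to (enumerateΣ a)

lookup-take : ∀ {A : Set} m {n} (xs : Vec A (m ℕ.+ n)) j → lookup xs (j ↑ˡ n) ≡ lookup (take m xs) j
lookup-take m {n} xs j = trans (cong (λ v → lookup v (j ↑ˡ n)) (sym (take++drop≡id m xs))) (lookup-++ˡ (take m xs) (drop m xs) j)

lookup-drop : ∀ {A : Set} m {n} (xs : Vec A (m ℕ.+ n)) j → lookup xs (m ↑ʳ j) ≡ lookup (drop m xs) j
lookup-drop m xs j = trans (cong (λ v → lookup v (m ↑ʳ j)) (sym (take++drop≡id m xs))) (lookup-++ʳ (take m xs) (drop m xs) j)

lookup-counts : ∀ {s} (a : Fin s → ℕ) I i → lookup (counts a I) i ≤ a i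
lookup-counts a I zero    = ∣p∣≤n (take (a zero) I)
lookup-counts a I (suc i) = lookup-counts (a ∘ suc) (drop (a zero) I) i

filled⇒member⇒< : ∀ {s} (a : Fin s → ℕ) I → Filled a I → ∀ i j →
  lookup I (index a (i , j)) ≡ inside → toℕ j < lookup (counts a I) i
filled⇒member⇒< a I (p , _) zero    j q =
  initial⇒member⇒< (take (a zero) I) p j (trans (sym (lookup-take (a zero) I j)) q)
filled⇒member⇒< a I (_ , p) (suc i) j q =
  filled⇒member⇒< (a ∘ suc) (drop (a zero) I) p i j (trans (sym (lookup-drop (a zero) I (index (a ∘ suc) (i , j)))) q)

filled⇒<⇒member : ∀ {s} (a : Fin s → ℕ) I → Filled a I → ∀ i j →
  toℕ j < lookup (counts a I) i → lookup I (index a (i , j)) ≡ inside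
filled⇒<⇒member a I (p , _) zero    j q =
  trans (lookup-take (a zero) I j) (initial⇒<⇒member (take (a zero) I) p j q)
filled⇒<⇒member a I (_ , p) (suc i) j q =
  trans (lookup-drop (a zero) I (index (a ∘ suc) (i , j))) (filled⇒<⇒member (a ∘ suc) (drop (a zero) I) p i j q)

closed⇒filled : ∀ {s} (a : Fin s → ℕ) I →
  (∀ i j k → toℕ k ≤ toℕ j → lookup I (index a (i , j)) ≡ inside → lookup I (index a (i , k)) ≡ inside) →
  Filled a I
closed⇒filled {zero}  a I p = tt
closed⇒filled {suc s} a I p =
  closed⇒initial (take (a zero) I) (λ j k k≤j q →
    trans (sym (lookup-take (a zero) I k)) (p zero j k k≤j (trans (lookup-take (a zero) I j) q))) ,
  closed⇒filled (a ∘ suc) (drop (a zero) I) (λ i j k k≤j q →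
    trans (sym (lookup-drop (a zero) I (index (a ∘ suc) (i , k))))
      (p (suc i) j k k≤j (trans (lookup-drop (a zero) I (index (a ∘ suc) (i , j))) q)))

-- Weighted sums over linked height vectors

vecWeight : (ℕ → ℕ → ℤ) → ∀ {s} → (Fin s → ℕ) → Vec ℕ s → ℤ
vecWeight w a []      = 1ℤ
vecWeight w a (t ∷ c) = w (a zero) t * vecWeight w (a ∘ suc) c

module _ (l : ℕ) (w : ℕ → ℕ → ℤ) where
  open Cycle l w

  -- The indicator of all links is a product of indicators, so the sum over vectors can be nested
  -- one height at a time.
  ΣVec-linked≡path : ∀ {n} (a : Fin (suc n) → ℕ) t z →
    ΣVec (a ∘ suc) (λ c → indicator (linked? l a (t ∷ c) z) * vecWeight w a (t ∷ c)) ≡ path a t z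
  ΣVec-linked≡path {zero}  a t z = swap (allowed (a zero) t z) (w (a zero) t)
    where
    swap : ∀ i x → i * (x * 1ℤ) ≡ x * i
    swap = solve-∀
  ΣVec-linked≡path {suc n} a t z = begin
    (Σ[ u < m ] ΣVec a⁺⁺ (λ c → indicator (linked? l a (t ∷ u ∷ c) z) * (w (a zero) t * vecWeight w a⁺ (u ∷ c))))
      ≡⟨ Σ<-cong m (λ u _ → trans (ΣVec-cong a⁺⁺ (separate u))
           (ΣVec-*ˡ a⁺⁺ (w (a zero) t * allowed (a zero) t u)
             (λ c → indicator (linked? l a⁺ (u ∷ c) z) * vecWeight w a⁺ (u ∷ c)))) ⟩
    (Σ[ u < m ] w (a zero) t * allowed (a zero) t u *
      ΣVec a⁺⁺ (λ c → indicator (linked? l a⁺ (u ∷ c) z) * vecWeight w a⁺ (u ∷ c)))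
      ≡⟨ Σ<-cong m (λ u _ → trans (cong (w (a zero) t * allowed (a zero) t u *_) (ΣVec-linked≡path a⁺ u z))
           (ℤ.*-assoc (w (a zero) t) (allowed (a zero) t u) (path a⁺ u z))) ⟩
    (Σ[ u < m ] w (a zero) t * (allowed (a zero) t u * path a⁺ u z))
      ≡⟨ Σ<-*ˡ m (w (a zero) t) (λ u → allowed (a zero) t u * path a⁺ u z) ⟩
    path a t z ∎
    where
    a⁺ : Fin (suc n) → ℕ
    a⁺ = a ∘ suc
    a⁺⁺ : Fin n → ℕ
    a⁺⁺ = a⁺ ∘ suc
    m : ℕ
    m = suc (a⁺ zero)
    rearrange : ∀ i j x y → i * j * (x * y) ≡ x * i * (j * y)
    rearrange = solve-∀
    separate : ∀ u c → indicator (linked? l a (t ∷ u ∷ c) z) * (w (a zero) t * vecWeight w a⁺ (u ∷ c)) ≡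
      w (a zero) t * allowed (a zero) t u * (indicator (linked? l a⁺ (u ∷ c) z) * vecWeight w a⁺ (u ∷ c))
    separate u c = trans
      (cong (_* (w (a zero) t * vecWeight w a⁺ (u ∷ c)))
        (indicator-× (t ≤? u ℕ.+ (a zero ∸ l)) (linked? l a⁺ (u ∷ c) z)))
      (rearrange (allowed (a zero) t u) (indicator (linked? l a⁺ (u ∷ c) z)) (w (a zero) t) (vecWeight w a⁺ (u ∷ c)))

  ΣVec-linked≡cycleSum : ∀ {n} (a : Fin (suc n) → ℕ) →
    ΣVec a (λ c → indicator (linked? l a c (head c)) * vecWeight w a c) ≡ cycleSum a
  ΣVec-linked≡cycleSum a = Σ<-cong (suc (a zero)) (λ t _ → ΣVec-linked≡path a t t)

+-∸-interchange : ∀ {m n j k} → j ≤ m → k ≤ n → m ℕ.+ n ∸ (j ℕ.+ k) ≡ (m ∸ j) ℕ.+ (n ∸ k)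
+-∸-interchange {m} {n} {j} {k} j≤m k≤n = begin
  m ℕ.+ n ∸ (j ℕ.+ k)   ≡⟨ ℕ.∸-+-assoc (m ℕ.+ n) j k ⟨
  m ℕ.+ n ∸ j ∸ k       ≡⟨ cong (_∸ k) (ℕ.+-∸-comm n j≤m) ⟩
  m ∸ j ℕ.+ n ∸ k       ≡⟨ ℕ.+-∸-assoc (m ∸ j) k≤n ⟩
  (m ∸ j) ℕ.+ (n ∸ k)   ∎

module _ (l : ℕ) (q : ℤ) where
  open Evaluated l q using (ascending; descending)

  vecWeight-ascending : ∀ {s} (a : Fin s → ℕ) I → q ^ ∣ I ∣ ≡ vecWeight ascending a (counts a I)
  vecWeight-ascending {zero}  a [] = refl
  vecWeight-ascending {suc s} a I  = begin
    q ^ ∣ I ∣                            ≡⟨ cong (q ^_) (∣take∣+∣drop∣ (a zero) I) ⟩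
    q ^ (∣ take (a zero) I ∣ ℕ.+ ∣ drop (a zero) I ∣)
                                         ≡⟨ ℤ.^-distribˡ-+-* q ∣ take (a zero) I ∣ ∣ drop (a zero) I ∣ ⟩
    q ^ ∣ take (a zero) I ∣ * q ^ ∣ drop (a zero) I ∣
                                         ≡⟨ cong (q ^ ∣ take (a zero) I ∣ *_) (vecWeight-ascending (a ∘ suc) (drop (a zero) I)) ⟩
    vecWeight ascending a (counts a I)   ∎

  vecWeight-descending : ∀ {s} (a : Fin s → ℕ) I → q ^ (total a ∸ ∣ I ∣) ≡ vecWeight descending a (counts a I)
  vecWeight-descending {zero}  a [] = refl
  vecWeight-descending {suc s} a I  = begin
    q ^ (total a ∸ ∣ I ∣)                ≡⟨ cong (q ^_) (trans (cong (total a ∸_) (∣take∣+∣drop∣ (a zero) I))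
                                              (+-∸-interchange (∣p∣≤n (take (a zero) I)) (∣p∣≤n (drop (a zero) I)))) ⟩
    q ^ ((a zero ∸ ∣ take (a zero) I ∣) ℕ.+ (total (a ∘ suc) ∸ ∣ drop (a zero) I ∣))
                                         ≡⟨ ℤ.^-distribˡ-+-* q (a zero ∸ ∣ take (a zero) I ∣) (total (a ∘ suc) ∸ ∣ drop (a zero) I ∣) ⟩
    q ^ (a zero ∸ ∣ take (a zero) I ∣) * q ^ (total (a ∘ suc) ∸ ∣ drop (a zero) I ∣)
                                         ≡⟨ cong (q ^ (a zero ∸ ∣ take (a zero) I ∣) *_) (vecWeight-descending (a ∘ suc) (drop (a zero) I)) ⟩
    vecWeight descending a (counts a I)  ∎

-- Lower ideals of the chainlink poset

module _ {n : ℕ} {{nonEmpty : NonZero (suc n)}} (part : Fin (suc n) → ℕ) (positive : ∀ i → NonZero (part i))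
         (l : ℕ) {{_ : NonZero l}} (2l≤a : ∀ i → 2 ℕ.* l ≤ part i) where

  composition : Composition
  composition = record { length = suc n ; part = part ; positive = positive }

  P : FinitePoset
  P = P-CL composition l 2l≤a

  open Chainlink composition l using (_⊑_; ⊑⇒≼; ≼⇒⊑; below-l; l≤a)

  LinkedFilling : Subset (total part) → Set
  LinkedFilling I = Filled part I × Linked l part (counts part I) (head (counts part I))

  linkedFilling? : ∀ I → Dec (LinkedFilling I)
  linkedFilling? I = filled? part I ×-dec linked? l part (counts part I) (head (counts part I))

  lowerIdeal⇒linkedFilling : ∀ I → IsLowerIdeal P I → LinkedFilling I
  lowerIdeal⇒linkedFilling I lower = filled , ⇒linked l part c (head c) λ i →
    subst (λ t → lookup c i ≤ t ℕ.+ (part i ∸ l)) (sym (lookup-rotate c i)) (ℕ.≮⇒≥ (link-violated i))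
    where
    c : Vec ℕ (suc n)
    c = counts part I
    closed : ∀ x y → x ⊑ y → lookup I (index part y) ≡ inside → lookup I (index part x) ≡ inside
    closed x y x⊑y p = []=⇒lookup (lower x y (⊑⇒≼ 2l≤a x⊑y) (lookup⇒[]= (index part y) I p))
    filled : Filled part I
    filled = closed⇒filled part I λ i j k k≤j → closed (i , k) (i , j) (inj₁ (refl , k≤j))
    link-violated : ∀ i → ¬ (lookup c (cyclicSuc i) ℕ.+ (part i ∸ l) < lookup c i)
    -- Let u be the height of the next chain, so that its element with index u is the first one
    -- missing. A violated link puts the element u + (a i - l) of chain i into the ideal, although
    -- it lies above the missing one.
    link-violated i v = ℕ.<-irrefl (Fin.toℕ-fromℕ< low<a)
      (filled⇒member⇒< part I filled (cyclicSuc i) (fromℕ< low<a)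
        (closed (cyclicSuc i , fromℕ< low<a) (i , fromℕ< high<a)
          (inj₂ (refl , ℕ.≤-reflexive (trans (cong (ℕ._+ (part i ∸ l)) (Fin.toℕ-fromℕ< low<a)) (sym (Fin.toℕ-fromℕ< high<a)))))
          (filled⇒<⇒member part I filled i (fromℕ< high<a) (subst (_< lookup c i) (sym (Fin.toℕ-fromℕ< high<a)) v))))
      where
      high<a : lookup c (cyclicSuc i) ℕ.+ (part i ∸ l) < part i
      high<a = ℕ.<-≤-trans v (lookup-counts part I i)
      low<a : lookup c (cyclicSuc i) < part (cyclicSuc i)
      low<a = ℕ.<-≤-trans (below-l 2l≤a i ℕ.≤-refl high<a) (l≤a 2l≤a (cyclicSuc i))

  -- The explicit order `⊑` leaves two cases. Within a chain the initial segment suffices; across a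
  -- link, b + (a i - l) ≤ t < c i ≤ c k + (a i - l), and cancellation gives b < c k.
  linkedFilling⇒lowerIdeal : ∀ I → LinkedFilling I → IsLowerIdeal P I
  linkedFilling⇒lowerIdeal I (filled , linked) x y x≼y y∈I =
    lookup⇒[]= (index part x) I (closed x y (≼⇒⊑ 2l≤a x≼y) ([]=⇒lookup y∈I))
    where
    c : Vec ℕ (suc n)
    c = counts part I
    closed : ∀ x y → x ⊑ y → lookup I (index part y) ≡ inside → lookup I (index part x) ≡ inside
    closed (k , b) (i , t) (inj₁ (refl , b≤t)) p =
      filled⇒<⇒member part I filled i b (ℕ.≤-<-trans b≤t (filled⇒member⇒< part I filled i t p))
    closed (k , b) (i , t) (inj₂ (refl , b+a-l≤t)) p =
      filled⇒<⇒member part I filled k b (ℕ.+-cancelʳ-< (part i ∸ l) (toℕ b) (lookup c k)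
        (ℕ.≤-<-trans b+a-l≤t (ℕ.<-≤-trans (filled⇒member⇒< part I filled i t p)
          (subst (λ u → lookup c i ≤ u ℕ.+ (part i ∸ l)) (lookup-rotate c i) (linked⇒ l part c (head c) linked i)))))

  -- The exponent and the weight are kept general in order to cover both the rank polynomial and its
  -- reversal.
  eval-lowerIdeals : ∀ (w : ℕ → ℕ → ℤ) q (f : Subset (total part) → ℕ) →
    (∀ I → q ^ f I ≡ vecWeight w part (counts part I)) →
    eval q (∑ (List.map (λ I → q^ f I) (lowerIdeals P))) ≡ Cycle.cycleSum l w part
  eval-lowerIdeals w q f weight≡ = begin
    eval q (∑ (List.map (λ I → q^ f I) (lowerIdeals P)))
      ≡⟨ eval-∑-filter (isLowerIdeal? P) q f (subsets (total part)) ⟩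
    ΣSubset (total part) (λ I → indicator (isLowerIdeal? P I) * q ^ f I)
      ≡⟨ ΣList-cong (subsets (total part)) term ⟩
    ΣSubset (total part) (λ I → indicator (filled? part I) * H (counts part I))
      ≡⟨ ΣSubset-filled part H ⟩
    ΣVec part H
      ≡⟨ ΣVec-linked≡cycleSum l w part ⟩
    Cycle.cycleSum l w part ∎
    where
    H : Vec ℕ (suc n) → ℤ
    H c = indicator (linked? l part c (head c)) * vecWeight w part c
    term : ∀ I → indicator (isLowerIdeal? P I) * q ^ f I ≡ indicator (filled? part I) * H (counts part I)
    term I = trans
      (cong₂ _*_
        (trans (indicator-cong (isLowerIdeal? P I) (linkedFilling? I) (lowerIdeal⇒linkedFilling I) (linkedFilling⇒lowerIdeal I))
          (indicator-× (filled? part I) (linked? l part (counts part I) (head (counts part I)))))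
        (weight≡ I))
      (ℤ.*-assoc (indicator (filled? part I)) (indicator (linked? l part (counts part I) (head (counts part I))))
        (vecWeight w part (counts part I)))

  rankPolynomial-symmetric : Symmetric (rankPolynomial P)
  rankPolynomial-symmetric = subst Symmetric (cong ∑ (sym (List.map-∘ (lowerIdeals P))))
    -- The exponent of the symmetry is the number of elements of the poset, and reflection replaces
    -- the size of each ideal by that of its complement.
    (symmetric-if-reflected-eval (total part) (List.map ∣_∣ (lowerIdeals P))
      (All.map⁺ (All.universal ∣p∣≤n (lowerIdeals P)))
      λ k → begin
        eval (+ suc k) (∑ (List.map q^_ (List.map ∣_∣ (lowerIdeals P))))
          ≡⟨ cong (λ f → eval (+ suc k) (∑ f)) (List.map-∘ (lowerIdeals P)) ⟨
        eval (+ suc k) (∑ (List.map (λ I → q^ ∣ I ∣) (lowerIdeals P)))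
          ≡⟨ eval-lowerIdeals (Evaluated.ascending l (+ suc k)) (+ suc k) ∣_∣ (vecWeight-ascending l (+ suc k) part) ⟩
        Cycle.cycleSum l (Evaluated.ascending l (+ suc k)) part
          ≡⟨ Evaluated.cycleSum-reverse l (+ suc k) part 2l≤a ⟩
        Cycle.cycleSum l (Evaluated.descending l (+ suc k)) part
          ≡⟨ eval-lowerIdeals (Evaluated.descending l (+ suc k)) (+ suc k) (λ I → total part ∸ ∣ I ∣) (vecWeight-descending l (+ suc k) part) ⟨
        eval (+ suc k) (∑ (List.map (λ I → q^ (total part ∸ ∣ I ∣)) (lowerIdeals P)))
          ≡⟨ cong (λ f → eval (+ suc k) (∑ f)) (List.map-∘ (lowerIdeals P)) ⟩
        eval (+ suc k) (∑ (List.map (λ m → q^ (total part ∸ m)) (List.map ∣_∣ (lowerIdeals P)))) ∎)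

corollary4p7 : (a : Composition) (l : ℕ) {{_ : NonZero l}} →
    (2l≤a : ∀ i → 2 ℕ.* l ≤ Composition.part a i) →
    Symmetric (rankPolynomial (P-CL a l 2l≤a))
-- Length zero is excluded by the `NonZero` field of a composition.
corollary4p7 record { length = suc n ; part = part ; positive = positive } l 2l≤a =
  rankPolynomial-symmetric part positive l 2l≤a
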